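{- Let $G=(V,E)$ be a finite DAG. The maxoid fan $\mathcal{F}_G$ of $G$ coincides with the (outer) normal fan of the polytope $$P_G:=\sum_{\substack{i,j\in V\\ |P(i,j)|\ge1}}\operatorname{Newt}(f_{ij})$$ (Minkowski sum over pairs of distinct nodes $i,j$). In particular, $\mathcal{F}_G$ is the normal fan of the Newton polytope $\operatorname{Newt}\big(\prod f_{ij}\big)$ of the product of the path polynomials $f_{ij}$ over all $i,j$ with $|P(i,j)|\ge1$.
   Context: Let $G=(V,E)$ be a finite DAG. $\mathbb{R}^E$ denotes the set of weight matrices supported on $G$: $V\times V$ matrices $C=(c_{ij})$ with $c_{ij}\in\mathbb{R}$ if $i\to j\in E$ and $c_{ij}=-\infty$ otherwise (identified with the Euclidean space indexed by $E$). For distinct $i,j\in V$, $P(i,j)$ is the set of directed paths from $i$ to $j$ in $G$, and the weight of a path $\pi$ is $\omega_C(\pi)=\sum_{e\in\pi}c_e$. A path in $P(i,j)$ is critical (for $(G,C)$) if its weight is maximal among all paths in $P(i,j)$. $C$ is generic if for all distinct $i,j$ with $P(i,j)\ne\emptyset$ there is exactly one critical path from $i$ to $j$. For $L\subseteq V$, the critical DAG $G^*_{C,L}$ is the DAG on $V$ with an edge $i\to j$ ($i\neq j$) if and only if $P(i,j)\neq\emptyset$ and no critical path from $i$ to $j$ in $(G,C)$ has an interior node in $L$. Distinct $i,j\in V\setminus L$ are $C^*$-connected given $L$ if $G^*_{C,L}$ contains, up to exchanging $i$ and $j$, a path of one of the forms (a) $i\to j$; (b) $i\leftarrow p\to j$;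 (c) $i\to \ell\leftarrow j$; (d) $i\leftarrow p\to\ell\leftarrow j$; (e) $i\leftarrow p\to\ell\leftarrow q\to j$, with $\ell\in L$ and $p,q\notin L$. Otherwise they are $C^*$-separated given $L$. For pairwise disjoint $I,J,L\subseteq V$, $I$ and $J$ are $C^*$-separated given $L$ if every $i\in I$ and $j\in J$ are $C^*$-separated given $L$. The maxoid $\mathcal{M}_*(G,C)$ is the set of all triples (CI statements) $[I\perp\!\!\!\perp J\mid L]$ with $I,J,L$ pairwise disjoint such that $I$ and $J$ are $C^*$-separated given $L$ in $(G,C)$. For generic $C$, $\operatorname{cone}_G(C)=\{C'\in\mathbb{R}^E: C'\text{ generic},\ \mathcal{M}_*(G,C')=\mathcal{M}_*(G,C)\}$. The maxoid fan $\mathcal{F}_G$ is the complete polyhedral fan in $\mathbb{R}^E$ consisting of the Euclidean closures of the sets $\operatorname{cone}_G(C)$, $C$ generic, and all their faces. The path polynomial of a pair $i,j$ with $|P(i,j)|\geq1$ is $f_{ij}=\sum_{\pi\in P(i,j)}\prod_{u\to v\in\pi}x_{uv}\in\mathbb{R}[x_{uv}:u\to v\in E]$. $\operatorname{Newt}(f)\subset\mathbb{R}^E$ is the convex hull of the exponent vectors of the terms of $f$. The outer normal fan of a polytope $P\subset\mathbb{R}^E$ consists of the cones $N_F=\{c: \langle c,x\rangle=\max_{y\in P}\langle c,y\rangle\text{ for all }x\in F\}$ for the non-empty faces $F$ of $P$. -}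

module Defs where

open import Algebra.Bundles using (CommutativeRing)
open import Data.Empty using (⊥-elim)
open import Data.Fin.Base as Fin using (Fin; zero; suc)
open import Data.Fin.Properties using (_≟_; pigeonhole)
open import Data.Fin.Subset using (Subset; _∈_; _∉_; _∩_; Empty)
open import Data.List.Base using (List; []; _∷_; _++_; map; concatMap; foldr; length; upTo; allFin; filter; cartesianProduct; cartesianProductWith)
import Data.List.Membership.Propositional as Mem
open import Data.List.Membership.Propositional.Properties using (∈-concatMap⁺; ∈-map⁺; ∈-allFin; ∈-upTo⁺)
open import Data.List.Relation.Unary.Any using (here)
open import Data.Nat.Base as ℕ using (ℕ; zero; suc; s≤s; s<s)
import Data.Nat.Properties as ℕ
open import Data.Product using (Σ-syntax; ∃-syntax; _×_; _,_; uncurry)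
open import Data.Sum.Base using (_⊎_)
open import Data.Vec.Base as Vec using (Vec)
open import Data.Vec.Functional using (Vector)
open import Data.Vec.Properties using (≡-dec)
open import Function.Base using (_∘_)
open import Level as Level using (0ℓ)
open import Relation.Binary.Construct.Closure.ReflexiveTransitive using (Star; ε; _◅_)
open import Relation.Binary.Construct.Closure.Transitive using (TransClosure; [_]; _∷_)
open import Relation.Binary.Core using (Rel)
open import Relation.Binary.PropositionalEquality using (_≡_; _≢_; refl; sym; subst)
open import Relation.Binary.Structures using (IsTotalOrder)
import Relation.Binary.Construct.NonStrictToStrict as ToStrict
open import Relation.Nullary using (¬_; yes; no; ¬?; _×-dec_)
open import Relation.Unary using (Pred; _≐_; Satisfiable; Decidable)

-- The real numbers, characterised (classically up to unique isomorphism) as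
-- a Dedekind-complete ordered field.
record CompleteOrderedField : Set₁ where
  infix 4 _≤_
  field
    commutativeRing : CommutativeRing 0ℓ 0ℓ
  open CommutativeRing commutativeRing public hiding (_-_)
  field
    _≤_          : Rel Carrier 0ℓ
    isTotalOrder : IsTotalOrder _≈_ _≤_
    1≉0          : ¬ (1# ≈ 0#)
    inverse      : ∀ x → ¬ (x ≈ 0#) → ∃[ y ] x * y ≈ 1#
    +-monoʳ-≤    : ∀ z {x y} → x ≤ y → z + x ≤ z + y
    *-nonneg     : ∀ {x y} → 0# ≤ x → 0# ≤ y → 0# ≤ x * y

  UpperBound : Pred Carrier 0ℓ → Pred Carrier 0ℓ
  UpperBound A b = ∀ x → A x → x ≤ b

  field
    supremum : ∀ (A : Pred Carrier 0ℓ) → Satisfiable A → Satisfiable (UpperBound A) →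
               ∃[ s ] UpperBound A s × (∀ b → UpperBound A b → s ≤ b)

  open ToStrict _≈_ _≤_ public using (_<_)

  infixl 6 _-_
  _-_ : Carrier → Carrier → Carrier
  x - y = x + (- y)

-- Vertices and edges are enumerated, so that functions on E are vectors
-- indexed by Fin ∣E∣.
record DAG : Set where
  infix 4 _⟶_
  field
    ∣V∣ ∣E∣ : ℕ
    src tgt : Fin ∣E∣ → Fin ∣V∣
    simple  : ∀ e e′ → src e ≡ src e′ → tgt e ≡ tgt e′ → e ≡ e′

  V : Set
  V = Fin ∣V∣

  E : Set
  E = Fin ∣E∣

  _⟶_ : Rel V 0ℓ
  i ⟶ j = Σ[ e ∈ E ] src e ≡ i × tgt e ≡ j

  field
    acyclic : ∀ i → ¬ TransClosure _⟶_ i i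

  -- In an acyclic graph no walk repeats a node, so walks are paths.
  Path : V → V → Set
  Path = Star _⟶_

  interior : ∀ {i j} → Path i j → List V
  interior ε                       = []
  interior (_ ◅ ε)                 = []
  interior (_◅_ {j = k} _ (a ◅ π)) = k ∷ interior (a ◅ π)

  edges : ∀ {i j} → Path i j → List E
  edges ε             = []
  edges ((e , _) ◅ π) = e ∷ edges π

  pathsOfLength : ℕ → ∀ i j → List (Path i j)
  pathsOfLength zero i j with i ≟ j
  ... | yes refl = ε ∷ []
  ... | no  _    = []
  pathsOfLength (suc k) i j = concatMap via (allFin ∣E∣)
    module Extend where
    via : E → List (Path i j)
    via e with src e ≟ i
    ... | yes p = map ((e , p , refl) ◅_) (pathsOfLength k (tgt e) j)
    ... | no  _ = []

  -- Each path once: in a DAG a path has fewer than ∣V∣ edges (see ∈-P).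
  P : ∀ i j → List (Path i j)
  P i j = concatMap (λ k → pathsOfLength k i j) (upTo ∣V∣)

  private
    len : ∀ {i j} → Path i j → ℕ
    len ε       = zero
    len (_ ◅ π) = suc (len π)

    ∈-pathsOfLength : ∀ {i j} (π : Path i j) → π Mem.∈ pathsOfLength (len π) i j
    ∈-pathsOfLength {i} ε with i ≟ i
    ... | yes refl = here refl
    ... | no  i≢i  = ⊥-elim (i≢i refl)
    ∈-pathsOfLength {i} {j} ((e , refl , refl) ◅ π) =
      ∈-concatMap⁺ (Extend.via (len π) i j) (Mem.lose (∈-allFin e) in-via)
      where
      in-via : ((e , refl , refl) ◅ π) Mem.∈ Extend.via (len π) i j e
      in-via with src e ≟ i
      ... | yes refl = ∈-map⁺ _ (∈-pathsOfLength π)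
      ... | no  ¬p   = ⊥-elim (¬p refl)

    node : ∀ {i j} (π : Path i j) → Fin (suc (len π)) → V
    node {i} _       zero    = i
    node     (_ ◅ π) (suc a) = node π a

    reach : ∀ {i j k} → i ⟶ k → (π : Path k j) (b : Fin (suc (len π))) →
            TransClosure _⟶_ i (node π b)
    reach a π       zero    = [ a ]
    reach a (c ◅ π) (suc b) = a ∷ reach c π b

    reach< : ∀ {i j} (π : Path i j) a b → a Fin.< b → TransClosure _⟶_ (node π a) (node π b)
    reach< (c ◅ π) zero    (suc b) _       = reach c π b
    reach< (_ ◅ π) (suc a) (suc b) (s<s p) = reach< π a b p

    len<∣V∣ : ∀ {i j} (π : Path i j) → len π ℕ.< ∣V∣
    len<∣V∣ π with len π ℕ.<? ∣V∣
    ... | yes p = p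
    ... | no ¬p with pigeonhole (s≤s (ℕ.≮⇒≥ ¬p)) (node π)
    ...   | a , b , a<b , eq = ⊥-elim (acyclic _ (subst (TransClosure _⟶_ _) (sym eq) (reach< π a b a<b)))

  ∈-P : ∀ {i j} (π : Path i j) → π Mem.∈ P i j
  ∈-P {i} {j} π =
    ∈-concatMap⁺ (λ k → pathsOfLength k i j) (Mem.lose (∈-upTo⁺ (len<∣V∣ π)) (∈-pathsOfLength π))

  connectedPairs : List (V × V)
  connectedPairs = filter connected? (cartesianProduct (allFin ∣V∣) (allFin ∣V∣))
    where
    connected? : Decidable {A = V × V} (λ (i , j) → i ≢ j × 1 ℕ.≤ length (P i j))
    connected? (i , j) = ¬? (i ≟ j) ×-dec (1 ℕ.≤? length (P i j))

module Euclidean (ℝ : CompleteOrderedField) (n : ℕ) where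
  open CompleteOrderedField ℝ hiding (refl; sym)
  open import Algebra.Properties.Semiring.Sum semiring using (sum)

  ℝⁿ : Set
  ℝⁿ = Vector Carrier n

  infix 4 _≋_
  _≋_ : Rel ℝⁿ 0ℓ
  x ≋ y = ∀ e → x e ≈ y e

  ⟨_,_⟩ : ℝⁿ → ℝⁿ → Carrier
  ⟨ x , y ⟩ = sum (λ e → x e * y e)

  -- The condition ∥ x - y ∥ < r, squared.
  closure : Pred ℝⁿ 0ℓ → Pred ℝⁿ 0ℓ
  closure S x = ∀ r → 0# < r → ∃[ y ] S y × ⟨ (λ e → x e - y e) , (λ e → x e - y e) ⟩ < r * r

  conv : Pred ℝⁿ 0ℓ → Pred ℝⁿ 0ℓ
  conv A x = Σ[ k ∈ ℕ ] Σ[ c ∈ Vector Carrier k ] Σ[ a ∈ Vector ℝⁿ k ]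
    (∀ t → 0# ≤ c t) × sum c ≈ 1# × (∀ t → A (a t)) × x ≋ (λ e → sum (λ t → c t * a t e))

  infixl 6 _⊕_
  _⊕_ : Pred ℝⁿ 0ℓ → Pred ℝⁿ 0ℓ → Pred ℝⁿ 0ℓ
  (A ⊕ B) x = ∃[ a ] ∃[ b ] A a × B b × x ≋ (λ e → a e + b e)

  origin : Pred ℝⁿ 0ℓ
  origin x = x ≋ (λ _ → 0#)

  minkowskiSum : List (Pred ℝⁿ 0ℓ) → Pred ℝⁿ 0ℓ
  minkowskiSum = foldr _⊕_ origin

  face : ℝⁿ → Pred ℝⁿ 0ℓ → Pred ℝⁿ 0ℓ
  face u S x = S x × (∀ y → S y → ⟨ u , y ⟩ ≤ ⟨ u , x ⟩)

  -- Non-empty faces of a polyhedron S; u = 0 gives S itself.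
  IsFace : Pred ℝⁿ 0ℓ → Pred ℝⁿ 0ℓ → Set
  IsFace F S = Satisfiable F × ∃[ u ] F ≐ face u S

  normalCone : Pred ℝⁿ 0ℓ → Pred ℝⁿ 0ℓ → Pred ℝⁿ 0ℓ
  normalCone Q F c = ∀ x → F x → ∀ y → Q y → ⟨ c , y ⟩ ≤ ⟨ c , x ⟩

  -- A fan is represented as the family of its cones.
  Fan : Set₂
  Fan = Pred (Pred ℝⁿ 0ℓ) (Level.suc 0ℓ)

  normalFan : Pred ℝⁿ 0ℓ → Fan
  normalFan Q S = ∃[ F ] IsFace F Q × S ≐ normalCone Q F

module Polynomial (ℝ : CompleteOrderedField) (n : ℕ) where
  open CompleteOrderedField ℝ hiding (refl; sym)
  open import Algebra.Properties.Semiring.Mult semiring using () renaming (_×_ to _·_)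
  open Euclidean ℝ n using (ℝⁿ; _≋_; conv)

  Exponent : Set
  Exponent = Vec ℕ n

  -- Unreduced formal sums of terms: the same exponent may occur repeatedly,
  -- and only the total coefficient (coeff) of a monomial is meaningful.
  Poly : Set
  Poly = List (Carrier × Exponent)

  coeff : Poly → Exponent → Carrier
  coeff []            α = 0#
  coeff ((c , β) ∷ f) α with ≡-dec ℕ._≟_ β α
  ... | yes _ = c + coeff f α
  ... | no  _ = coeff f α

  1ₚ : Poly
  1ₚ = (1# , Vec.replicate n 0) ∷ []

  var : Fin n → Poly
  var e = (1# , Vec.replicate n 0 Vec.[ e ]≔ 1) ∷ []

  _*ₚ_ : Poly → Poly → Poly
  _*ₚ_ = cartesianProductWith λ (c , α) (d , β) → c * d , Vec.zipWith ℕ._+_ α β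

  ∑ₚ ∏ₚ : List Poly → Poly
  ∑ₚ = foldr _++_ []
  ∏ₚ = foldr _*ₚ_ 1ₚ

  toℝⁿ : Exponent → ℝⁿ
  toℝⁿ α e = Vec.lookup α e · 1#

  Newt : Poly → Pred ℝⁿ 0ℓ
  Newt f = conv λ x → ∃[ α ] ¬ (coeff f α ≈ 0#) × x ≋ toℝⁿ α

module Maxoid (ℝ : CompleteOrderedField) (G : DAG) where
  open CompleteOrderedField ℝ hiding (refl; sym)
  open DAG G
  open Euclidean ℝ ∣E∣
  open Polynomial ℝ ∣E∣

  ℝᴱ : Set
  ℝᴱ = ℝⁿ

  weight : ℝᴱ → ∀ {i j} → Path i j → Carrier
  weight C π = foldr _+_ 0# (map C (edges π))

  Critical : ℝᴱ → ∀ {i j} → Path i j → Set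
  Critical C {i} {j} π = ∀ (ρ : Path i j) → weight C ρ ≤ weight C π

  Generic : Pred ℝᴱ 0ℓ
  Generic C = ∀ i j → i ≢ j → Path i j →
    Σ[ π ∈ Path i j ] Critical C π × (∀ ρ → Critical C ρ → ρ ≡ π)

  -- Edges of the critical DAG G*_{C,L}.
  CriticalEdge : ℝᴱ → Subset ∣V∣ → Rel V 0ℓ
  CriticalEdge C L i j = i ≢ j × Path i j ×
    (∀ (π : Path i j) → Critical C π → ∀ k → k Mem.∈ interior π → k ∉ L)

  module _ (C : ℝᴱ) (L : Subset ∣V∣) where
    private
      infix 4 _⇝_
      _⇝_ : Rel V 0ℓ
      _⇝_ = CriticalEdge C L

    -- The inequations say that the nodes of the path are distinct; those
    -- omitted hold because edges join distinct nodes, because ℓ ∈ L while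
    -- p, q ∉ L, and because connectedness is only considered for distinct
    -- i, j ∉ L.
    data ConnectingPath (i j : V) : Set where
      form-a : i ⇝ j → ConnectingPath i j
      form-b : ∀ p → p ∉ L → p ⇝ i → p ⇝ j → ConnectingPath i j
      form-c : ∀ ℓ → ℓ ∈ L → i ⇝ ℓ → j ⇝ ℓ → ConnectingPath i j
      form-d : ∀ p ℓ → p ∉ L → ℓ ∈ L → p ≢ j →
               p ⇝ i → p ⇝ ℓ → j ⇝ ℓ → ConnectingPath i j
      form-e : ∀ p ℓ q → p ∉ L → ℓ ∈ L → q ∉ L → p ≢ q → p ≢ j → q ≢ i →
               p ⇝ i → p ⇝ ℓ → q ⇝ ℓ → q ⇝ j → ConnectingPath i j

    Separated : V → V → Set
    Separated i j = ¬ (ConnectingPath i j ⊎ ConnectingPath j i)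

  CIStatement : Set
  CIStatement = Subset ∣V∣ × Subset ∣V∣ × Subset ∣V∣

  maxoid : ℝᴱ → Pred CIStatement 0ℓ
  maxoid C (I , J , L) =
    Empty (I ∩ J) × Empty (I ∩ L) × Empty (J ∩ L) ×
    (∀ i j → i ∈ I → j ∈ J → Separated C L i j)

  cone : ℝᴱ → Pred ℝᴱ 0ℓ
  cone C C′ = Generic C′ × maxoid C′ ≐ maxoid C

  maxoidFan : Pred (Pred ℝᴱ 0ℓ) 0ℓ
  maxoidFan S = ∃[ C ] Generic C × (S ≐ closure (cone C) ⊎ IsFace S (closure (cone C)))

  pathPolynomial : V → V → Poly
  pathPolynomial i j = ∑ₚ (map (λ π → ∏ₚ (map var (edges π))) (P i j))

  pathPolytope : Pred ℝᴱ 0ℓ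
  pathPolytope = minkowskiSum (map (Newt ∘ uncurry pathPolynomial) connectedPairs)

  pathPolynomialProduct : Poly
  pathPolynomialProduct = ∏ₚ (map (uncurry pathPolynomial) connectedPairs)

{-# OPTIONS --safe #-}

-- For u ∈ ℝᴱ let K(u) be the cone of all x for which every u-critical path is
-- x-critical. Both fans consist exactly of the cones K(u).
--
-- Normal fan: either polytope is the convex hull of the points ∑ π_ij, one for each
-- choice of a path π_ij for every connected pair, and such a point maximises the
-- linear functional x iff all π_ij are x-critical. So the normal cone of the face
-- selected by u is K(u).
--
-- Maxoid fan: the maxoid of a generic C determines the critical paths of C, hence
-- the closure of cone(C) is K(C). A face of K(C) is K(c) for a point c of the face
-- with as few critical paths as possible. Conversely, every u is a limit of
-- generic C having only u-critical paths as critical paths, and then K(u) is cut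
-- out of K(C) by equalities among its defining inequalities.
module Submission where

open import Defs
open import Axiom.ExcludedMiddle using (ExcludedMiddle)
open import Data.Bool.Base using (true)
open import Data.Empty using (⊥-elim)
open import Data.Fin.Base using (Fin; zero; suc)
open import Data.Fin.Properties using (_≟_)
open import Data.Fin.Subset using (Subset; _∈_; _∉_; ⁅_⁆)
open import Data.Fin.Subset.Properties using (x∈⁅x⁆; x∈⁅y⁆⇒x≡y; x∈p∩q⁻)
open import Data.List.Base using (List; []; _∷_; map; concatMap; length; allFin; cartesianProduct)
import Data.List.Extrema as Extrema
open import Data.List.Membership.Propositional using (find; lose) renaming (_∈_ to _∈ˡ_)
open import Data.List.Membership.Propositional.Properties
  using (∈-allFin; ∈-cartesianProduct⁺; ∈-cartesianProductWith⁺; ∈-cartesianProductWith⁻;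
         ∈-concatMap⁺; ∈-concatMap⁻; ∈-filter⁺; ∈-filter⁻; ∈-length; ∈-map⁺)
open import Data.List.Relation.Unary.All as All using (All; []; _∷_)
open import Data.List.Relation.Unary.Any using (here; there)
open import Data.Nat.Base as ℕ using (ℕ; zero; suc)
open import Data.Nat.Properties using () renaming (_≟_ to _≟ℕ_)
open import Data.Product using (_×_; _,_; proj₁; proj₂; ∃-syntax; Σ-syntax; swap; uncurry)
import Data.Sum.Base as Sum
open import Data.Sum.Base using (_⊎_; inj₁; inj₂)
open import Data.Unit.Base using (⊤; tt)
import Data.Vec.Base as Vec
open import Data.Vec.Functional using (Vector)
open import Data.Vec.Properties
  using (≡-dec; lookup-replicate; lookup-zipWith; lookup∘tabulate; lookup⇒[]=; []=⇒lookup)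
open import Function.Base using (_∘_; id)
open import Level using (0ℓ)
open import Relation.Binary.Bundles using (TotalOrder)
open import Relation.Binary.Construct.Closure.ReflexiveTransitive using (ε; _◅_; _◅◅_)
open import Relation.Binary.Construct.Closure.Transitive using (TransClosure; [_]; _∷_)
import Relation.Binary.Construct.NonStrictToStrict as ToStrict
open import Relation.Binary.PropositionalEquality as ≡ using (_≡_; _≢_)
import Relation.Binary.Reasoning.PartialOrder as PartialOrderReasoning
open import Relation.Nullary using (¬_; Dec; yes; no; does)
open import Relation.Nullary.Decidable using (dec-true)
open import Relation.Unary using (Pred; _≐_; _⊆_; Satisfiable)
open import Relation.Unary.Properties using (≐-sym; ≐-trans)

-- The fact behind both halves is that u is a relative interior point of K(u): for every x in K(u)
-- some u - tx with t > 0 is again in K(u). There are only finitely many pairs of paths with common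
-- ends, so a single t preserves all strict inequalities between their u-weights. Since x and -x are
-- then both admissible directions at u, an inequality between values of linear functionals can be
-- reversed. This identifies the normal cones, and it shows that a face of K(C) contains all of K(c)
-- as soon as it contains c. Polytopes are seen only through the values of linear functionals. On
-- the polynomial side this works because all coefficients are positive: monomials of the product
-- may coincide, but they never cancel.

-- Ordered field arithmetic and perturbation of strict inequalities.

module OrderedField (ℝ : CompleteOrderedField) where
  open CompleteOrderedField ℝ
  open import Algebra.Properties.Ring ring using (-‿distribʳ-*; -‿distribˡ-*; -‿involutive; +-cancelˡ)
  open import Algebra.Solver.Ring.NaturalCoefficients.Default commutativeSemiring
    using (solve; _:+_; _:*_; _:=_; con)

  totalOrder : TotalOrder 0ℓ 0ℓ 0ℓ
  totalOrder = record { isTotalOrder = isTotalOrder }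

  open TotalOrder totalOrder public using (poset; total)
    renaming (reflexive to ≤-reflexive; refl to ≤-refl; trans to ≤-trans; antisym to ≤-antisym)

  module ≤-Reasoning = PartialOrderReasoning poset
  open ≤-Reasoning

  ≰⇒> : ∀ {x y} → ¬ (x ≤ y) → y < x
  ≰⇒> = ToStrict.≰⇒> _≈_ _≤_ sym ≤-reflexive total

  <⇒≱ : ∀ {x y} → x < y → ¬ (y ≤ x)
  <⇒≱ = ToStrict.<⇒≱ _≈_ _≤_ ≤-antisym

  +-monoˡ-≤ : ∀ z {x y} → x ≤ y → x + z ≤ y + z
  +-monoˡ-≤ z {x} {y} x≤y = begin
    x + z ≈⟨ +-comm x z ⟩
    z + x ≤⟨ +-monoʳ-≤ z x≤y ⟩
    z + y ≈⟨ +-comm z y ⟩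
    y + z ∎

  +-mono-≤ : ∀ {x y u v} → x ≤ y → u ≤ v → x + u ≤ y + v
  +-mono-≤ x≤y u≤v = ≤-trans (+-monoˡ-≤ _ x≤y) (+-monoʳ-≤ _ u≤v)

  +-monoʳ-< : ∀ z {x y} → x < y → z + x < z + y
  +-monoʳ-< z {x} {y} (x≤y , x≉y) = +-monoʳ-≤ z x≤y , x≉y ∘ +-cancelˡ z x y

  +-monoˡ-< : ∀ z {x y} → x < y → x + z < y + z
  +-monoˡ-< z {x} {y} x<y = begin-strict
    x + z ≈⟨ +-comm x z ⟩
    z + x <⟨ +-monoʳ-< z x<y ⟩
    z + y ≈⟨ +-comm z y ⟩
    y + z ∎

  -z+[z+x] : ∀ z x → - z + (z + x) ≈ x
  -z+[z+x] z x = trans (sym (+-assoc (- z) z x)) (trans (+-congʳ (-‿inverseˡ z)) (+-identityˡ x))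

  z+[-z+x] : ∀ z x → z + (- z + x) ≈ x
  z+[-z+x] z x = trans (sym (+-assoc z (- z) x)) (trans (+-congʳ (-‿inverseʳ z)) (+-identityˡ x))

  +-cancelˡ-≤ : ∀ z {x y} → z + x ≤ z + y → x ≤ y
  +-cancelˡ-≤ z {x} {y} p = begin
    x             ≈⟨ -z+[z+x] z x ⟨
    - z + (z + x) ≤⟨ +-monoʳ-≤ (- z) p ⟩
    - z + (z + y) ≈⟨ -z+[z+x] z y ⟩
    y             ∎

  +-cancelʳ-≤ : ∀ z {x y} → x + z ≤ y + z → x ≤ y
  +-cancelʳ-≤ z {x} {y} p = +-cancelˡ-≤ z (begin
    z + x ≈⟨ +-comm z x ⟩
    x + z ≤⟨ p ⟩
    y + z ≈⟨ +-comm y z ⟩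
    z + y ∎)

  x≤y⇒0≤-x+y : ∀ {x y} → x ≤ y → 0# ≤ - x + y
  x≤y⇒0≤-x+y {x} {y} x≤y = +-cancelˡ-≤ x (begin
    x + 0#        ≈⟨ +-identityʳ x ⟩
    x             ≤⟨ x≤y ⟩
    y             ≈⟨ z+[-z+x] x y ⟨
    x + (- x + y) ∎)

  x<y⇒0<-x+y : ∀ {x y} → x < y → 0# < - x + y
  x<y⇒0<-x+y {x} {y} (x≤y , x≉y) = x≤y⇒0≤-x+y x≤y , λ 0≈ → x≉y (begin-equality
    x             ≈⟨ +-identityʳ x ⟨
    x + 0#        ≈⟨ +-congˡ 0≈ ⟩
    x + (- x + y) ≈⟨ z+[-z+x] x y ⟩
    y             ∎)

  *-monoʳ-≤ : ∀ {z} → 0# ≤ z → ∀ {x y} → x ≤ y → z * x ≤ z * y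
  *-monoʳ-≤ {z} 0≤z {x} {y} x≤y = begin
    z * x                   ≈⟨ +-identityʳ (z * x) ⟨
    z * x + 0#              ≤⟨ +-monoʳ-≤ (z * x) (*-nonneg 0≤z (x≤y⇒0≤-x+y x≤y)) ⟩
    z * x + z * (- x + y)   ≈⟨ distribˡ z x (- x + y) ⟨
    z * (x + (- x + y))     ≈⟨ *-congˡ (z+[-z+x] x y) ⟩
    z * y                   ∎

  *-monoˡ-≤ : ∀ {z} → 0# ≤ z → ∀ {x y} → x ≤ y → x * z ≤ y * z
  *-monoˡ-≤ {z} 0≤z {x} {y} x≤y = begin
    x * z ≈⟨ *-comm x z ⟩
    z * x ≤⟨ *-monoʳ-≤ 0≤z x≤y ⟩
    z * y ≈⟨ *-comm z y ⟩
    y * z ∎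

  x≤0⇒0≤-x : ∀ {x} → x ≤ 0# → 0# ≤ - x
  x≤0⇒0≤-x x≤0 = ≤-trans (x≤y⇒0≤-x+y x≤0) (≤-reflexive (+-identityʳ _))

  -x*-y≈x*y : ∀ x y → - x * - y ≈ x * y
  -x*-y≈x*y x y = begin-equality
    - x * - y     ≈⟨ -‿distribˡ-* x (- y) ⟨
    - (x * - y)   ≈⟨ -‿cong (-‿distribʳ-* x y) ⟨
    - - (x * y)   ≈⟨ -‿involutive (x * y) ⟩
    x * y         ∎

  0≤x*x : ∀ x → 0# ≤ x * x
  0≤x*x x with total 0# x
  ... | inj₁ 0≤x = *-nonneg 0≤x 0≤x
  ... | inj₂ x≤0 = ≤-trans (*-nonneg (x≤0⇒0≤-x x≤0) (x≤0⇒0≤-x x≤0)) (≤-reflexive (-x*-y≈x*y x x))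

  0<1 : 0# < 1#
  0<1 = ≤-trans (0≤x*x 1#) (≤-reflexive (*-identityˡ 1#)) , 1≉0 ∘ sym

  reciprocal : ∀ {x} → 0# < x → ∃[ y ] 0# < y × x * y ≈ 1#
  reciprocal {x} (0≤x , 0≉x) with inverse x (0≉x ∘ sym)
  ... | y , xy≈1 = y , ≰⇒> y≰0 , xy≈1
    where
    y≰0 : ¬ (y ≤ 0#)
    y≰0 y≤0 = <⇒≱ 0<1 (begin
      1#     ≈⟨ xy≈1 ⟨
      x * y  ≤⟨ *-monoʳ-≤ 0≤x y≤0 ⟩
      x * 0# ≈⟨ zeroʳ x ⟩
      0#     ∎)

  *-monoʳ-< : ∀ {z} → 0# < z → ∀ {x y} → x < y → z * x < z * y
  *-monoʳ-< {z} 0<z {x} {y} (x≤y , x≉y) with reciprocal 0<z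
  ... | z⁻¹ , _ , zz⁻¹≈1 = *-monoʳ-≤ (proj₁ 0<z) x≤y , λ zx≈zy → x≉y (begin-equality
    x             ≈⟨ cancel x ⟨
    z⁻¹ * (z * x) ≈⟨ *-congˡ zx≈zy ⟩
    z⁻¹ * (z * y) ≈⟨ cancel y ⟩
    y             ∎)
    where
    cancel : ∀ a → z⁻¹ * (z * a) ≈ a
    cancel a = begin-equality
      z⁻¹ * (z * a) ≈⟨ solve 3 (λ w v u → w :* (v :* u) := (v :* w) :* u) refl z⁻¹ z a ⟩
      z * z⁻¹ * a   ≈⟨ *-congʳ zz⁻¹≈1 ⟩
      1# * a        ≈⟨ *-identityˡ a ⟩
      a             ∎

  *-pos : ∀ {x y} → 0# < x → 0# < y → 0# < x * y
  *-pos {x} {y} 0<x 0<y = begin-strict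
    0#     ≈⟨ zeroʳ x ⟨
    x * 0# <⟨ *-monoʳ-< 0<x 0<y ⟩
    x * y  ∎

  -- `closure` compares squared distances. Applied to a difference and to its negative, this
  -- recovers a two-sided bound on each coordinate.
  square-cancel-≤ : ∀ {r z} → 0# < r → z * z < r * r → z ≤ r
  square-cancel-≤ {r} {z} 0<r zz<rr with total z r
  ... | inj₁ z≤r = z≤r
  ... | inj₂ r≤z = ⊥-elim (<⇒≱ zz<rr (begin
    r * r ≤⟨ *-monoʳ-≤ (proj₁ 0<r) r≤z ⟩
    r * z ≤⟨ *-monoˡ-≤ (≤-trans (proj₁ 0<r) r≤z) r≤z ⟩
    z * z ∎))

  -- The threshold `t` works for all smaller `s` as well, so that finitely many thresholds can be
  -- merged by taking their minimum.
  small-multiple : ∀ {a} b → 0# < a → ∃[ t ] 0# < t × (∀ {s} → 0# < s → s ≤ t → s * b < a)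
  small-multiple {a} b 0<a with total b 0#
  ... | inj₁ b≤0 = 1# , 0<1 , λ {s} 0<s _ → begin-strict
    s * b  ≤⟨ *-monoʳ-≤ (proj₁ 0<s) b≤0 ⟩
    s * 0# ≈⟨ zeroʳ s ⟩
    0#     <⟨ 0<a ⟩
    a      ∎
  -- The threshold is a / (b + 1): unlike `b`, the denominator is positive even when `b` is zero,
  -- and b / (b + 1) < 1 makes the bound strict.
  ... | inj₂ 0≤b with reciprocal {b + 1#} (begin-strict
        0#     <⟨ 0<1 ⟩
        1#     ≈⟨ +-identityˡ 1# ⟨
        0# + 1# ≤⟨ +-monoˡ-≤ 1# 0≤b ⟩
        b + 1# ∎)
  ...   | y , 0<y , [b+1]y≈1 = a * y , *-pos 0<a 0<y , λ {s} 0<s s≤t → begin-strict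
    s * b                 ≤⟨ *-monoˡ-≤ 0≤b s≤t ⟩
    a * y * b             ≈⟨ +-identityʳ _ ⟨
    a * y * b + 0#        <⟨ +-monoʳ-< _ (*-pos 0<a 0<y) ⟩
    a * y * b + a * y     ≈⟨ solve 3 (λ a y b → a :* y :* b :+ a :* y := a :* ((b :+ con 1) :* y)) refl a y b ⟩
    a * ((b + 1#) * y)    ≈⟨ *-congˡ [b+1]y≈1 ⟩
    a * 1#                ≈⟨ *-identityʳ a ⟩
    a                     ∎

  -- The claim amounts to s (f′ - g′) < g - f, a small multiple against a positive gap.
  perturb₁ : ∀ {f g} f′ g′ → f < g →
             ∃[ t ] 0# < t × (∀ {s} → 0# < s → s ≤ t → f + s * f′ < g + s * g′)
  perturb₁ {f} {g} f′ g′ f<g with small-multiple (- g′ + f′) (x<y⇒0<-x+y f<g)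
  ... | t , 0<t , small = t , 0<t , λ {s} 0<s s≤t → begin-strict
    f + s * f′                         ≈⟨ +-congˡ (*-congˡ (z+[-z+x] g′ f′)) ⟨
    f + s * (g′ + (- g′ + f′))         ≈⟨ solve 4 (λ f s g d → f :+ s :* (g :+ d) := (f :+ s :* g) :+ s :* d)
                                             refl f s g′ (- g′ + f′) ⟩
    f + s * g′ + s * (- g′ + f′)       <⟨ +-monoʳ-< _ (small 0<s s≤t) ⟩
    f + s * g′ + (- f + g)             ≈⟨ solve 3 (λ f p d → (f :+ p) :+ d := (f :+ d) :+ p) refl f (s * g′) (- f + g) ⟩
    f + (- f + g) + s * g′             ≈⟨ +-congʳ (z+[-z+x] f g) ⟩
    g + s * g′                         ∎

  module _ (em : ExcludedMiddle 0ℓ) {A : Set} (f g f′ g′ : A → Carrier) where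

    perturb : ∀ xs → ∃[ t ] 0# < t × (∀ {s} → 0# < s → s ≤ t →
              ∀ {a} → a ∈ˡ xs → f a < g a → f a + s * f′ a < g a + s * g′ a)
    perturb [] = 1# , 0<1 , λ _ _ ()
    perturb (x ∷ xs) with perturb xs | em {f x < g x}
    ... | t , 0<t , small | no fx≮gx = t , 0<t , λ where
      _ _ (here ≡.refl) fx<gx → ⊥-elim (fx≮gx fx<gx)
      0<s s≤t (there a∈)      → small 0<s s≤t a∈
    ... | t , 0<t , small | yes fx<gx with perturb₁ (f′ x) (g′ x) fx<gx
    ...   | t′ , 0<t′ , small′ with total t t′
    ...     | inj₁ t≤t′ = t , 0<t , λ where
      0<s s≤t (here ≡.refl) _ → small′ 0<s (≤-trans s≤t t≤t′)
      0<s s≤t (there a∈)      → small 0<s s≤t a∈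
    ...     | inj₂ t′≤t = t′ , 0<t′ , λ where
      0<s s≤t (here ≡.refl) _ → small′ 0<s s≤t
      0<s s≤t (there a∈)      → small 0<s (≤-trans s≤t t′≤t) a∈

-- Finite sums and inner products.

module EuclideanProperties (ℝ : CompleteOrderedField) (n : ℕ) where
  open CompleteOrderedField ℝ hiding (zero)
  open OrderedField ℝ
  open ≤-Reasoning
  open Euclidean ℝ n
  open import Algebra.Properties.Semiring.Sum semiring using (sum; sum-cong-≋; ∑-distrib-+; *-distribˡ-sum)
  open import Algebra.Solver.Ring.NaturalCoefficients.Default commutativeSemiring
    using (solve; _:*_; _:=_)

  infixl 6 _+[_]_
  _+[_]_ : ℝⁿ → Carrier → ℝⁿ → ℝⁿ
  (u +[ t ] w) e = u e + t * w e

  neg : ℝⁿ → ℝⁿ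
  neg x e = - x e

  sum-mono-≤ : ∀ {m} {f g : Vector Carrier m} → (∀ i → f i ≤ g i) → sum f ≤ sum g
  sum-mono-≤ {zero}  f≤g = ≤-refl
  sum-mono-≤ {suc m} f≤g = +-mono-≤ (f≤g zero) (sum-mono-≤ (f≤g ∘ suc))

  0≤sum : ∀ {m} {f : Vector Carrier m} → (∀ i → 0# ≤ f i) → 0# ≤ sum f
  0≤sum {zero}  0≤f = ≤-refl
  0≤sum {suc m} {f} 0≤f = begin
    0#                 ≈⟨ +-identityˡ 0# ⟨
    0# + 0#            ≤⟨ +-mono-≤ (0≤f zero) (0≤sum (0≤f ∘ suc)) ⟩
    f zero + sum (f ∘ suc) ∎

  component≤sum : ∀ {m} {f : Vector Carrier m} → (∀ i → 0# ≤ f i) → ∀ i → f i ≤ sum f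
  component≤sum {suc m} {f} 0≤f zero = begin
    f zero      ≈⟨ +-identityʳ (f zero) ⟨
    f zero + 0# ≤⟨ +-monoʳ-≤ (f zero) (0≤sum (0≤f ∘ suc)) ⟩
    sum f       ∎
  component≤sum {suc m} {f} 0≤f (suc i) = begin
    f (suc i)               ≈⟨ +-identityˡ (f (suc i)) ⟨
    0# + f (suc i)          ≤⟨ +-mono-≤ (0≤f zero) (component≤sum (0≤f ∘ suc) i) ⟩
    f zero + sum (f ∘ suc)  ∎

  ⟨⟩-comm : ∀ x y → ⟨ x , y ⟩ ≈ ⟨ y , x ⟩
  ⟨⟩-comm x y = sum-cong-≋ λ e → *-comm (x e) (y e)

  ⟨⟩-cong : ∀ {x x′ y y′} → x ≋ x′ → y ≋ y′ → ⟨ x , y ⟩ ≈ ⟨ x′ , y′ ⟩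
  ⟨⟩-cong x≋x′ y≋y′ = sum-cong-≋ λ e → *-cong (x≋x′ e) (y≋y′ e)

  ⟨⟩-+ʳ : ∀ u x y → ⟨ u , (λ e → x e + y e) ⟩ ≈ ⟨ u , x ⟩ + ⟨ u , y ⟩
  ⟨⟩-+ʳ u x y = trans (sum-cong-≋ λ e → distribˡ (u e) (x e) (y e)) (∑-distrib-+ (λ e → u e * x e) (λ e → u e * y e))

  ⟨⟩-0ʳ : ∀ u → ⟨ u , (λ _ → 0#) ⟩ ≈ 0#
  ⟨⟩-0ʳ u = begin-equality
    ⟨ u , (λ _ → 0#) ⟩        ≈⟨ sum-cong-≋ (λ e → *-comm (u e) 0#) ⟩
    sum {n} (λ e → 0# * u e)  ≈⟨ *-distribˡ-sum 0# u ⟨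
    0# * sum u                ≈⟨ zeroˡ (sum u) ⟩
    0#                        ∎

  ⟨⟩-scaleʳ : ∀ u t x → ⟨ u , (λ e → t * x e) ⟩ ≈ t * ⟨ u , x ⟩
  ⟨⟩-scaleʳ u t x = trans
    (sum-cong-≋ λ e → solve 3 (λ u t x → u :* (t :* x) := t :* (u :* x)) refl (u e) t (x e))
    (sym (*-distribˡ-sum t (λ e → u e * x e)))

  ⟨⟩-+[]ʳ : ∀ u x t w → ⟨ u , x +[ t ] w ⟩ ≈ ⟨ u , x ⟩ + t * ⟨ u , w ⟩
  ⟨⟩-+[]ʳ u x t w = trans (⟨⟩-+ʳ u x (λ e → t * w e)) (+-congˡ (⟨⟩-scaleʳ u t w))

  ⟨⟩-+[]ˡ : ∀ x t w y → ⟨ x +[ t ] w , y ⟩ ≈ ⟨ x , y ⟩ + t * ⟨ w , y ⟩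
  ⟨⟩-+[]ˡ x t w y = begin-equality
    ⟨ x +[ t ] w , y ⟩         ≈⟨ ⟨⟩-comm _ y ⟩
    ⟨ y , x +[ t ] w ⟩         ≈⟨ ⟨⟩-+[]ʳ y x t w ⟩
    ⟨ y , x ⟩ + t * ⟨ y , w ⟩  ≈⟨ +-cong (⟨⟩-comm y x) (*-congˡ (⟨⟩-comm y w)) ⟩
    ⟨ x , y ⟩ + t * ⟨ w , y ⟩  ∎

  ⟨⟩+⟨neg⟩ : ∀ x y → ⟨ x , y ⟩ + ⟨ neg x , y ⟩ ≈ 0#
  ⟨⟩+⟨neg⟩ x y = begin-equality
    ⟨ x , y ⟩ + ⟨ neg x , y ⟩      ≈⟨ ∑-distrib-+ (λ e → x e * y e) (λ e → neg x e * y e) ⟨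
    sum (λ e → x e * y e + - x e * y e)
                                   ≈⟨ sum-cong-≋ (λ e → trans (sym (distribʳ (y e) (x e) (- x e)))
                                                       (trans (*-congʳ (-‿inverseʳ (x e)))
                                                       (trans (*-comm 0# (y e)) refl))) ⟩
    ⟨ y , (λ _ → 0#) ⟩             ≈⟨ ⟨⟩-0ʳ y ⟩
    0#                             ∎

  component²≤⟨⟩ : ∀ z e → z e * z e ≤ ⟨ z , z ⟩
  component²≤⟨⟩ z = component≤sum (λ e → 0≤x*x (z e))

-- Paths in an acyclic graph.

module Paths (G : DAG) where
  open DAG G

  no-cycle : ∀ {i k} → i ⟶ k → ¬ Path k i
  no-cycle a π = acyclic _ (closed a π)
    where
    closed : ∀ {i j k} → i ⟶ k → Path k j → TransClosure _⟶_ i j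
    closed a ε       = [ a ]
    closed a (b ◅ π) = a ∷ closed b π

  ↝-antisym : ∀ {i j} → Path i j → Path j i → i ≡ j
  ↝-antisym ε       ρ = ≡.refl
  ↝-antisym (a ◅ π) ρ = ⊥-elim (no-cycle a (π ◅◅ ρ))

  cycle-trivial : ∀ {i} (π : Path i i) → π ≡ ε
  cycle-trivial ε       = ≡.refl
  cycle-trivial (a ◅ π) = ⊥-elim (no-cycle a π)

  ⟶-unique : ∀ {i j} (a b : i ⟶ j) → a ≡ b
  ⟶-unique (e , ≡.refl , ≡.refl) (e′ , p , q) with simple e e′ (≡.sym p) (≡.sym q)
  ⟶-unique (e , ≡.refl , ≡.refl) (e , ≡.refl , ≡.refl) | ≡.refl = ≡.refl

  interior-between : ∀ {i j m k} (a : i ⟶ m) (π : Path m j) → k ∈ˡ interior (a ◅ π) → Path m k × Path k j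
  interior-between a (b ◅ π) (here ≡.refl) = ε , b ◅ π
  interior-between a (b ◅ π) (there k∈) with interior-between b π k∈
  ... | m′↝k , k↝j = b ◅ m′↝k , k↝j

  first∈interior : ∀ {i j m} (a : i ⟶ m) (π : Path m j) → m ≢ j → m ∈ˡ interior (a ◅ π)
  first∈interior a ε       m≢j = ⊥-elim (m≢j ≡.refl)
  first∈interior a (b ◅ π) m≢j = here ≡.refl

-- Critical paths and the maxoids they determine.

module CriticalPaths (em : ExcludedMiddle 0ℓ) (ℝ : CompleteOrderedField) (G : DAG) where
  open OrderedField ℝ using (totalOrder; +-cancelˡ-≤; ≤-refl)
  open DAG G
  open Paths G
  open Maxoid ℝ G

  -- Optimal substructure: prefixing the edge `a` to a competitor of `π` gives a competitor of
  -- `a ◅ π`.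
  critical-tail : ∀ C {i j k} (a : i ⟶ k) (π : Path k j) → Critical C (a ◅ π) → Critical C π
  critical-tail C a π crit ρ = +-cancelˡ-≤ (C (proj₁ a)) (crit (a ◅ ρ))

  -- Settles the diagonal pairs, over which `criticalCone` quantifies although `connectedPairs`
  -- omits them.
  critical-cycle : ∀ C {i} (π : Path i i) → Critical C π
  critical-cycle C π ρ with cycle-trivial π | cycle-trivial ρ
  ... | ≡.refl | ≡.refl = ≤-refl

  critical-exists : ∀ C {i j} → Path i j → ∃[ π ] Critical C {i} {j} π
  critical-exists C {i} {j} π₀ = argmax (weight C) π₀ (P i j) ,
    λ ρ → All.lookup (f[xs]≤f[argmax] π₀ (P i j)) (∈-P ρ)
    where open Extrema totalOrder

  critical-unique : ∀ {C} → Generic C → ∀ {i j} → i ≢ j → (π ρ : Path i j) →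
                    Critical C π → Critical C ρ → π ≡ ρ
  critical-unique gen i≢j π ρ π-crit ρ-crit with gen _ _ i≢j π
  ... | _ , _ , unique = ≡.trans (unique π π-crit) (≡.sym (unique ρ ρ-crit))

  module _ (Q : Pred V 0ℓ) where
    comprehension : Subset ∣V∣
    comprehension = Vec.tabulate λ v → does (em {Q v})

    ∈-comprehension⁺ : ∀ {v} → Q v → v ∈ comprehension
    ∈-comprehension⁺ {v} q =
      lookup⇒[]= v comprehension (≡.trans (lookup∘tabulate _ v) (dec-true em q))

    ∈-comprehension⁻ : ∀ {v} → v ∈ comprehension → Q v
    ∈-comprehension⁻ {v} v∈ = witness em (≡.trans (≡.sym (lookup∘tabulate _ v)) ([]=⇒lookup v∈))
      where
      witness : ∀ {A : Set} (d : Dec A) → does d ≡ true → A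
      witness (yes x) _ = x

  -- Let i → m and i → m′ start the critical paths for C and C′, and suppose
  -- that m does not reach m′. The conditioning set consists of the ancestors v
  -- of j that are not strictly below i or that reach m′. It misses the critical
  -- path for C and meets the one for C′. It contains all ancestors of i and,
  -- with a descendant ℓ of i, all ancestors of ℓ other than i, so that for C′
  -- no longer connecting path is open either.
  module Separation {C C′ : ℝᴱ} (C-gen : Generic C)
    {i j m m′} (a : i ⟶ m) (π : Path m j) (a′ : i ⟶ m′) (π′ : Path m′ j)
    (π-crit : Critical C (a ◅ π)) (π′-crit : Critical C′ (a′ ◅ π′))
    (m↝̸m′ : ¬ Path m m′) where

    InL : Pred V 0ℓ
    InL v = v ≢ i × v ≢ j × Path v j × (Path i v → Path v m′)

    L : Subset ∣V∣
    L = comprehension InL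

    i≢j : i ≢ j
    i≢j ≡.refl = no-cycle a π

    m′≢j : m′ ≢ j
    m′≢j ≡.refl = m↝̸m′ π

    m′∈L : m′ ∈ L
    m′∈L = ∈-comprehension⁺ InL ((λ { ≡.refl → no-cycle a′ ε }) , m′≢j , π′ , λ _ → ε)

    connected : ConnectingPath C L i j
    connected = form-a (i≢j , a ◅ π , λ ρ ρ-crit k k∈ k∈L → avoids ρ ρ-crit k∈ (∈-comprehension⁻ InL k∈L))
      where
      avoids : ∀ ρ → Critical C ρ → ∀ {k} → k ∈ˡ interior ρ → ¬ InL k
      avoids ρ ρ-crit k∈ (_ , _ , _ , below) with critical-unique C-gen i≢j ρ (a ◅ π) ρ-crit π-crit
      ... | ≡.refl with interior-between a π k∈
      -- A node of L below `i` reaches `m′`, and every interior node of this path is reached from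
      -- `m`; together they would join `m` to `m′`.
      ...   | m↝k , _ = m↝̸m′ (m↝k ◅◅ below (a ◅ m↝k))

    private
      infix 4 _⇝_
      _⇝_ : V → V → Set
      _⇝_ = CriticalEdge C′ L

    i⇝̸j : ¬ (i ⇝ j)
    i⇝̸j (_ , _ , avoid) = avoid _ π′-crit _ (first∈interior a′ π′ m′≢j) m′∈L

    parent-of-i : ∀ {p} → p ∉ L → ¬ (p ⇝ i)
    parent-of-i p∉L (p≢i , p↝i , _) = p∉L (∈-comprehension⁺ InL
      ( p≢i
      , (λ { ≡.refl → i≢j (↝-antisym (a ◅ π) p↝i) })
      , p↝i ◅◅ a ◅ π
      , λ i↝p → ⊥-elim (p≢i (↝-antisym p↝i i↝p)) ))

    child-of-j : ∀ {ℓ} → ℓ ∈ L → ¬ (j ⇝ ℓ)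
    child-of-j ℓ∈L (j≢ℓ , j↝ℓ , _) with ∈-comprehension⁻ InL ℓ∈L
    ... | _ , _ , ℓ↝j , _ = j≢ℓ (↝-antisym j↝ℓ ℓ↝j)

    -- Excludes form (d) read from `j` to `i`, the only form longer than one edge that uses neither
    -- a parent of `i` nor a child of `j`. The collider `ℓ` lies in L below `i`, so it reaches `m′`,
    -- and so does `p`; this puts `p` into L.
    co-parent-of-i : ∀ {p ℓ} → p ∉ L → ℓ ∈ L → p ≢ i → p ⇝ j → p ⇝ ℓ → ¬ (i ⇝ ℓ)
    co-parent-of-i p∉L ℓ∈L p≢i (p≢j , p↝j , _) (_ , p↝ℓ , _) (_ , i↝ℓ , _) with ∈-comprehension⁻ InL ℓ∈L
    ... | _ , _ , _ , below = p∉L (∈-comprehension⁺ InL (p≢i , p≢j , p↝j , λ _ → p↝ℓ ◅◅ below i↝ℓ))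

    separated : Separated C′ L i j
    separated (inj₁ (form-a i⇝j))                     = i⇝̸j i⇝j
    separated (inj₁ (form-b p p∉L p⇝i _))             = parent-of-i p∉L p⇝i
    separated (inj₁ (form-c ℓ ℓ∈L _ j⇝ℓ))             = child-of-j ℓ∈L j⇝ℓ
    separated (inj₁ (form-d p ℓ p∉L _ _ p⇝i _ _))     = parent-of-i p∉L p⇝i
    separated (inj₁ (form-e p ℓ q p∉L _ _ _ _ _ p⇝i _ _ _)) = parent-of-i p∉L p⇝i
    separated (inj₂ (form-a (_ , j↝i , _)))           = i≢j (↝-antisym (a ◅ π) j↝i)
    separated (inj₂ (form-b p p∉L _ p⇝i))             = parent-of-i p∉L p⇝i
    separated (inj₂ (form-c ℓ ℓ∈L j⇝ℓ _))             = child-of-j ℓ∈L j⇝ℓ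
    separated (inj₂ (form-d p ℓ p∉L ℓ∈L p≢i p⇝j p⇝ℓ i⇝ℓ)) = co-parent-of-i p∉L ℓ∈L p≢i p⇝j p⇝ℓ i⇝ℓ
    separated (inj₂ (form-e p ℓ q _ _ q∉L _ _ _ _ _ _ q⇝i)) = parent-of-i q∉L q⇝i

    distinguished : ¬ (maxoid C′ ⊆ maxoid C)
    distinguished M′⊆M with M′⊆M {⁅ i ⁆ , ⁅ j ⁆ , L}
      ( (λ (v , v∈) → let v∈i , v∈j = x∈p∩q⁻ ⁅ i ⁆ ⁅ j ⁆ v∈ in i≢j (≡.trans (≡.sym (x∈⁅y⁆⇒x≡y i v∈i)) (x∈⁅y⁆⇒x≡y j v∈j)))
      , (λ (v , v∈) → let v∈i , v∈L = x∈p∩q⁻ ⁅ i ⁆ L v∈ in proj₁ (∈-comprehension⁻ InL v∈L) (x∈⁅y⁆⇒x≡y i v∈i))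
      , (λ (v , v∈) → let v∈j , v∈L = x∈p∩q⁻ ⁅ j ⁆ L v∈ in proj₁ (proj₂ (∈-comprehension⁻ InL v∈L)) (x∈⁅y⁆⇒x≡y j v∈j))
      , λ u v u∈ v∈ → ≡.subst₂ (Separated C′ L) (≡.sym (x∈⁅y⁆⇒x≡y i u∈)) (≡.sym (x∈⁅y⁆⇒x≡y j v∈)) separated )
    ... | _ , _ , _ , sep = sep i j (x∈⁅x⁆ i) (x∈⁅x⁆ j) (inj₁ connected)

  module _ {C C′ : ℝᴱ} (C-gen : Generic C) (C′-gen : Generic C′) (M≐M′ : maxoid C ≐ maxoid C′) where

    -- Where the two paths first diverge, acyclicity prevents the two next nodes from reaching each
    -- other in both directions. The direction that fails decides in which order `Separation` takes
    -- `C` and `C′`, hence which inclusion of maxoids is contradicted.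
    same-critical : ∀ {i j} (π π′ : Path i j) → Critical C π → Critical C′ π′ → π ≡ π′
    same-critical ε        π′        _ _ = ≡.sym (cycle-trivial π′)
    same-critical (a ◅ π)  ε         _ _ = ⊥-elim (no-cycle a π)
    same-critical (_◅_ {j = m} a π) (_◅_ {j = m′} a′ π′) π-crit π′-crit with m ≟ m′ | em {Path m m′} | em {Path m′ m}
    ... | yes ≡.refl | _ | _ = ≡.cong₂ _◅_ (⟶-unique a a′)
          (same-critical π π′ (critical-tail C a π π-crit) (critical-tail C′ a′ π′ π′-crit))
    ... | no m≢m′ | yes m↝m′ | yes m′↝m = ⊥-elim (m≢m′ (↝-antisym m↝m′ m′↝m))
    ... | no _ | no m↝̸m′ | _ = ⊥-elim (Separation.distinguished C-gen a π a′ π′ π-crit π′-crit m↝̸m′ (proj₂ M≐M′))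
    ... | no _ | _ | no m′↝̸m = ⊥-elim (Separation.distinguished C′-gen a′ π′ a π π′-crit π-crit m′↝̸m (proj₁ M≐M′))

    critical-transfer : ∀ {i j} (π : Path i j) → Critical C π → Critical C′ π
    critical-transfer π π-crit with critical-exists C′ π
    ... | π′ , π′-crit with same-critical π π′ π-crit π′-crit
    ...   | ≡.refl = π′-crit

  -- Every additional critical path is one more that must avoid L, so the critical DAG for `C′` has
  -- no more edges than that for `C`, and separations persist.
  maxoid-antitone : ∀ {C C′} → (∀ {i j} (π : Path i j) → Critical C π → Critical C′ π) → maxoid C ⊆ maxoid C′
  maxoid-antitone {C} {C′} C⇒C′ {I , J , L} (I∩J , I∩L , J∩L , sep) = I∩J , I∩L , J∩L ,
    λ i j i∈I j∈J → sep i j i∈I j∈J ∘ Sum.map connecting connecting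
    where
    edge : ∀ {i j} → CriticalEdge C′ L i j → CriticalEdge C L i j
    edge (i≢j , π , avoid) = i≢j , π , λ ρ → avoid ρ ∘ C⇒C′ ρ

    connecting : ∀ {i j} → ConnectingPath C′ L i j → ConnectingPath C L i j
    connecting (form-a x)                         = form-a (edge x)
    connecting (form-b p p∉ x y)                  = form-b p p∉ (edge x) (edge y)
    connecting (form-c ℓ ℓ∈ x y)                  = form-c ℓ ℓ∈ (edge x) (edge y)
    connecting (form-d p ℓ p∉ ℓ∈ ne x y z)        = form-d p ℓ p∉ ℓ∈ ne (edge x) (edge y) (edge z)
    connecting (form-e p ℓ q p∉ ℓ∈ q∉ n₁ n₂ n₃ x y z w) =
      form-e p ℓ q p∉ ℓ∈ q∉ n₁ n₂ n₃ (edge x) (edge y) (edge z) (edge w)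

-- Coordinate vectors.

module Indicator (ℝ : CompleteOrderedField) where
  open CompleteOrderedField ℝ hiding (zero)
  open OrderedField ℝ using (0<1; ≤-refl)
  open import Algebra.Properties.Semiring.Sum semiring using (sum; sum-cong-≋; sum-replicate-zero)

  δ : ∀ {n} → Fin n → Fin n → Carrier
  δ zero    zero    = 1#
  δ zero    (suc _) = 0#
  δ (suc _) zero    = 0#
  δ (suc a) (suc e) = δ a e

  δ-diagonal : ∀ {n} (a : Fin n) → δ a a ≡ 1#
  δ-diagonal zero    = ≡.refl
  δ-diagonal (suc a) = δ-diagonal a

  δ-off-diagonal : ∀ {n} {a e : Fin n} → a ≢ e → δ a e ≡ 0#
  δ-off-diagonal {a = zero}  {zero}  a≢e = ⊥-elim (a≢e ≡.refl)
  δ-off-diagonal {a = zero}  {suc e} a≢e = ≡.refl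
  δ-off-diagonal {a = suc a} {zero}  a≢e = ≡.refl
  δ-off-diagonal {a = suc a} {suc e} a≢e = δ-off-diagonal (a≢e ∘ ≡.cong suc)

  0≤δ : ∀ {n} (a e : Fin n) → 0# ≤ δ a e
  0≤δ zero    zero    = proj₁ 0<1
  0≤δ zero    (suc _) = ≤-refl
  0≤δ (suc _) zero    = ≤-refl
  0≤δ (suc a) (suc e) = 0≤δ a e

  ⟨x,δ⟩ : ∀ {n} (x : Fin n → Carrier) a → sum (λ e → x e * δ a e) ≈ x a
  ⟨x,δ⟩ {suc n} x zero = trans
    (+-cong (*-identityʳ (x zero)) (trans (sum-cong-≋ (λ e → zeroʳ (x (suc e)))) (sum-replicate-zero n)))
    (+-identityʳ (x zero))
  ⟨x,δ⟩ {suc n} x (suc a) = trans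
    (+-cong (zeroʳ (x zero)) (⟨x,δ⟩ (x ∘ suc) a))
    (+-identityˡ (x (suc a)))

-- Critical cones.

module CriticalCones (em : ExcludedMiddle 0ℓ) (ℝ : CompleteOrderedField) (G : DAG) where
  open CompleteOrderedField ℝ hiding (zero)
  open OrderedField ℝ
  open ≤-Reasoning
  open DAG G
  open Paths G
  open CriticalPaths em ℝ G
  open Maxoid ℝ G
  open Euclidean ℝ ∣E∣
  open EuclideanProperties ℝ ∣E∣
  open Indicator ℝ
  open import Algebra.Properties.Ring ring using (-0#≈0#; -‿+-comm; +-cancelˡ)
  open import Algebra.Properties.AbelianGroup +-abelianGroup using (⁻¹-anti-homo‿-)
  open import Algebra.Solver.Ring.NaturalCoefficients.Default commutativeSemiring
    using (solve; _:+_; _:*_; _:=_)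

  weight-+[] : ∀ u t w {i j} (π : Path i j) → weight (u +[ t ] w) π ≈ weight u π + t * weight w π
  weight-+[] u t w ε = sym (trans (+-congˡ (zeroʳ t)) (+-identityˡ 0#))
  weight-+[] u t w ((e , _) ◅ π) = trans (+-congˡ (weight-+[] u t w π))
    (solve 5 (λ a t b x y → (a :+ t :* b) :+ (x :+ t :* y) := (a :+ x) :+ t :* (b :+ y)) refl
      (u e) t (w e) (weight u π) (weight w π))

  weight-mono : ∀ {u w} → (∀ e → u e ≤ w e) → ∀ {i j} (π : Path i j) → weight u π ≤ weight w π
  weight-mono u≤w ε             = ≤-refl
  weight-mono u≤w ((e , _) ◅ π) = +-mono-≤ (u≤w e) (weight-mono u≤w π)

  weight-neg : ∀ x {i j} (π : Path i j) → weight (neg x) π ≈ - weight x π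
  weight-neg x ε             = sym -0#≈0#
  weight-neg x ((e , _) ◅ π) = trans (+-congˡ (weight-neg x π)) (-‿+-comm (x e) (weight x π))

  weight-0 : ∀ {i j} (π : Path i j) → weight (λ _ → 0#) π ≈ 0#
  weight-0 ε       = refl
  weight-0 (_ ◅ π) = trans (+-identityˡ _) (weight-0 π)

  -- The exponent vector of the path's monomial, as a point of `ℝᴱ`; it turns path weights into
  -- linear functionals.
  edgeVector : ∀ {i j} → Path i j → ℝᴱ
  edgeVector ε             e′ = 0#
  edgeVector ((e , _) ◅ π) e′ = δ e e′ + edgeVector π e′

  ⟨⟩-edgeVector : ∀ x {i j} (π : Path i j) → ⟨ x , edgeVector π ⟩ ≈ weight x π
  ⟨⟩-edgeVector x ε             = ⟨⟩-0ʳ x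
  ⟨⟩-edgeVector x ((e , _) ◅ π) =
    trans (⟨⟩-+ʳ x (δ e) (edgeVector π)) (+-cong (⟨x,δ⟩ x e) (⟨⟩-edgeVector x π))

  criticalCone : ℝᴱ → Pred ℝᴱ 0ℓ
  criticalCone u x = ∀ {i j} (π : Path i j) → Critical u π → Critical x π

  -- Pairs of paths with common ends index the weight comparisons that define critical cones. Having
  -- them in one finite list permits a common step size, a sum over all comparisons and an induction
  -- that treats them one by one.
  Parallel : Set
  Parallel = Σ[ (i , j) ∈ V × V ] Path i j × Path i j

  parallels : List Parallel
  parallels = concatMap (λ ij → map (ij ,_) (cartesianProduct (P _ _) (P _ _)))
                        (cartesianProduct (allFin ∣V∣) (allFin ∣V∣))

  ∈-parallels : ∀ {i j} (π ρ : Path i j) → ((i , j) , π , ρ) ∈ˡ parallels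
  ∈-parallels {i} {j} π ρ = ∈-concatMap⁺ _
    (lose (∈-cartesianProduct⁺ (∈-allFin i) (∈-allFin j)) (∈-map⁺ _ (∈-cartesianProduct⁺ (∈-P π) (∈-P ρ))))

  perturb-weight : ∀ u w → ∃[ t ] 0# < t × (∀ {i j} (π ρ : Path i j) →
                   weight u π < weight u ρ → weight (u +[ t ] w) π < weight (u +[ t ] w) ρ)
  perturb-weight u w with perturb em
    (λ (_ , π , _) → weight u π) (λ (_ , _ , ρ) → weight u ρ)
    (λ (_ , π , _) → weight w π) (λ (_ , _ , ρ) → weight w ρ) parallels
  ... | t , 0<t , small = t , 0<t , λ π ρ uπ<uρ → begin-strict
    weight (u +[ t ] w) π       ≈⟨ weight-+[] u t w π ⟩
    weight u π + t * weight w π <⟨ small 0<t ≤-refl (∈-parallels π ρ) uπ<uρ ⟩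
    weight u ρ + t * weight w ρ ≈⟨ weight-+[] u t w ρ ⟨
    weight (u +[ t ] w) ρ       ∎

  criticalCone-+[] : ∀ {c t x y} → 0# ≤ t → criticalCone c x → criticalCone c y → criticalCone c (x +[ t ] y)
  criticalCone-+[] {c} {t} {x} {y} 0≤t cx cy π π-crit ρ = begin
    weight (x +[ t ] y) ρ       ≈⟨ weight-+[] x t y ρ ⟩
    weight x ρ + t * weight y ρ ≤⟨ +-mono-≤ (cx π π-crit ρ) (*-monoʳ-≤ 0≤t (cy π π-crit ρ)) ⟩
    weight x π + t * weight y π ≈⟨ weight-+[] x t y π ⟨
    weight (x +[ t ] y) π       ∎

  criticalCone-0 : ∀ c → criticalCone c (λ _ → 0#)
  criticalCone-0 c π _ ρ = ≤-reflexive (trans (weight-0 ρ) (sym (weight-0 π)))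

  -- A `c`-critical path `γ` is critical for `x` and for `y`. A path that matches `γ` in the
  -- combined weight cannot fall short of it in either summand, because it cannot exceed it in the
  -- other.
  critical-+[]⁻ : ∀ {c t x y} → 0# < t → criticalCone c x → criticalCone c y →
                  ∀ {i j} (π : Path i j) → Critical (x +[ t ] y) π → Critical x π × Critical y π
  critical-+[]⁻ {c} {t} {x} {y} 0<t cx cy π π-crit with critical-exists c π
  ... | γ , γ-crit = (λ ρ → ≤-trans (cx γ γ-crit ρ) xγ≤xπ) , (λ ρ → ≤-trans (cy γ γ-crit ρ) yγ≤yπ)
    where
    sum≤ : weight x γ + t * weight y γ ≤ weight x π + t * weight y π
    sum≤ = begin
      weight x γ + t * weight y γ ≈⟨ weight-+[] x t y γ ⟨
      weight (x +[ t ] y) γ       ≤⟨ π-crit γ ⟩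
      weight (x +[ t ] y) π       ≈⟨ weight-+[] x t y π ⟩
      weight x π + t * weight y π ∎

    xγ≤xπ : weight x γ ≤ weight x π
    xγ≤xπ = +-cancelʳ-≤ (t * weight y γ)
      (≤-trans sum≤ (+-monoʳ-≤ (weight x π) (*-monoʳ-≤ (proj₁ 0<t) (cy γ γ-crit π))))

    yγ≤yπ : weight y γ ≤ weight y π
    yγ≤yπ with em {weight y γ ≤ weight y π}
    ... | yes yγ≤yπ = yγ≤yπ
    ... | no  yγ≰yπ = ⊥-elim (<⇒≱ (begin-strict
      weight x π + t * weight y π <⟨ +-monoʳ-< (weight x π) (*-monoʳ-< 0<t (≰⇒> yγ≰yπ)) ⟩
      weight x π + t * weight y γ ≤⟨ +-monoˡ-≤ (t * weight y γ) (cx γ γ-crit π) ⟩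
      weight x γ + t * weight y γ ∎) sum≤)

  -- c lies in the relative interior of its critical cone.
  criticalCone-reflect : ∀ {c x} → criticalCone c x → ∃[ t ] 0# < t × criticalCone c (c +[ t ] neg x)
  criticalCone-reflect {c} {x} cx with perturb-weight c (neg x)
  ... | t , 0<t , small = t , 0<t , reflect
    where
    reflect : criticalCone c (c +[ t ] neg x)
    reflect π π-crit ρ with em {weight c π ≤ weight c ρ}
    ... | no  cπ≰cρ = proj₁ (small ρ π (≰⇒> cπ≰cρ))
    -- A tie with `π` makes `ρ` itself `c`-critical, so both paths are `x`-critical and subtracting
    -- a multiple of `x` keeps the tie.
    ... | yes cπ≤cρ = ≤-reflexive (begin-equality
      weight (c +[ t ] neg x) ρ         ≈⟨ weight-+[] c t (neg x) ρ ⟩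
      weight c ρ + t * weight (neg x) ρ ≈⟨ +-congˡ (*-congˡ (weight-neg x ρ)) ⟩
      weight c ρ + t * - weight x ρ     ≈⟨ +-cong (≤-antisym (π-crit ρ) cπ≤cρ) (*-congˡ (-‿cong xρ≈xπ)) ⟩
      weight c π + t * - weight x π     ≈⟨ +-congˡ (*-congˡ (weight-neg x π)) ⟨
      weight c π + t * weight (neg x) π ≈⟨ weight-+[] c t (neg x) π ⟨
      weight (c +[ t ] neg x) π         ∎)
      where
      ρ-crit : Critical c ρ
      ρ-crit σ = ≤-trans (π-crit σ) cπ≤cρ

      xρ≈xπ : weight x ρ ≈ weight x π
      xρ≈xπ = ≤-antisym (cx π π-crit ρ) (cx ρ ρ-crit π)

  difference≤ : ∀ {x y r} → x - y ≤ r → x ≤ y + r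
  difference≤ {x} {y} {r} x-y≤r = begin
    x             ≈⟨ z+[-z+x] y x ⟨
    y + (- y + x) ≈⟨ +-congˡ (+-comm (- y) x) ⟩
    y + (x - y)   ≤⟨ +-monoʳ-≤ y x-y≤r ⟩
    y + r         ∎

  closure-components : ∀ {x y : ℝᴱ} {r} → 0# < r → ⟨ (λ e → x e - y e) , (λ e → x e - y e) ⟩ < r * r →
                       ∀ e → x e ≤ y e + r × y e ≤ x e + r
  closure-components {x} {y} {r} 0<r near e =
    difference≤ (square-cancel-≤ 0<r square<) ,
    difference≤ (square-cancel-≤ 0<r (begin-strict
      (y e - x e) * (y e - x e)         ≈⟨ *-cong (⁻¹-anti-homo‿- (x e) (y e)) (⁻¹-anti-homo‿- (x e) (y e)) ⟨
      - (x e - y e) * - (x e - y e)     ≈⟨ -x*-y≈x*y (x e - y e) (x e - y e) ⟩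
      (x e - y e) * (x e - y e)         <⟨ square< ⟩
      r * r                             ∎))
    where
    square< : (x e - y e) * (x e - y e) < r * r
    square< = begin-strict
      (x e - y e) * (x e - y e) ≤⟨ component²≤⟨⟩ (λ e → x e - y e) e ⟩
      _                         <⟨ near ⟩
      r * r                     ∎

  -- Closures of maxoid cones.

  module _ {C : ℝᴱ} (C-gen : Generic C) where

    closure⊆criticalCone : closure (cone C) ⊆ criticalCone C
    closure⊆criticalCone {x} x∈ π π-crit ρ with em {weight x ρ ≤ weight x π}
    ... | yes xρ≤xπ = xρ≤xπ
    -- Moving each coordinate by at most `r` changes a path weight by at most `r` times its number
    -- of edges, which is its weight for the constant matrix 1. The radius is chosen so that the
    -- changes along `π` and `ρ` together stay below the gap in `x`, whereas `π` is critical for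
    -- every `y` in the cone.
    ... | no  xρ≰xπ with perturb₁ (weight (λ _ → 1#) π + weight (λ _ → 1#) ρ) 0# (≰⇒> xρ≰xπ)
    ...   | r , 0<r , small with x∈ r 0<r
    ...     | y , (y-gen , My≐MC) , near = ⊥-elim (<⇒≱ (small 0<r ≤-refl) (begin
      weight x ρ + r * 0#               ≈⟨ trans (+-congˡ (zeroʳ r)) (+-identityʳ _) ⟩
      weight x ρ                        ≤⟨ weight-mono (proj₁ ∘ close) ρ ⟩
      weight (y +[ r ] (λ _ → 1#)) ρ    ≈⟨ weight-+[] y r (λ _ → 1#) ρ ⟩
      weight y ρ + r * |ρ|              ≤⟨ +-monoˡ-≤ (r * |ρ|) (critical-transfer C-gen y-gen (swap My≐MC) π π-crit ρ) ⟩
      weight y π + r * |ρ|              ≤⟨ +-monoˡ-≤ (r * |ρ|) (weight-mono (proj₂ ∘ close) π) ⟩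
      weight (x +[ r ] (λ _ → 1#)) π + r * |ρ|
                                        ≈⟨ +-congʳ (weight-+[] x r (λ _ → 1#) π) ⟩
      weight x π + r * |π| + r * |ρ|    ≈⟨ solve 4 (λ x r p q → (x :+ r :* p) :+ r :* q := x :+ r :* (p :+ q))
                                            refl (weight x π) r |π| |ρ| ⟩
      weight x π + r * (|π| + |ρ|)      ∎))
      where
      |π| |ρ| : Carrier
      |π| = weight (λ _ → 1#) π
      |ρ| = weight (λ _ → 1#) ρ

      close : ∀ e → x e ≤ y e + r * 1# × y e ≤ x e + r * 1#
      close e with closure-components {x} {y} 0<r near e
      ... | x≤y+r , y≤x+r = ≤-trans x≤y+r (≤-reflexive (+-congˡ (sym (*-identityʳ r)))) ,
                            ≤-trans y≤x+r (≤-reflexive (+-congˡ (sym (*-identityʳ r))))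

    -- Adding `t * C` breaks the ties of `x` in favour of the `C`-critical paths, so the sum has
    -- exactly the critical paths of `C`.
    +[]∈cone : ∀ {t x} → 0# < t → criticalCone C x → cone C (x +[ t ] C)
    +[]∈cone {t} {x} 0<t cx = gen , maxoid-antitone down , maxoid-antitone up
      where
      up : criticalCone C (x +[ t ] C)
      up = criticalCone-+[] {C} {t} {x} {C} (proj₁ 0<t) cx (λ _ π-crit → π-crit)

      down : criticalCone (x +[ t ] C) C
      down π π-crit = proj₂ (critical-+[]⁻ {C} {t} {x} {C} 0<t cx (λ _ crit → crit) π π-crit)

      gen : Generic (x +[ t ] C)
      gen i j i≢j π₀ with C-gen i j i≢j π₀
      ... | π , π-crit , unique = π , up π π-crit , λ ρ ρ-crit → unique ρ (down ρ ρ-crit)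

    criticalCone⊆closure : criticalCone C ⊆ closure (cone C)
    criticalCone⊆closure {x} cx r 0<r with small-multiple ⟨ C , C ⟩ (*-pos 0<r 0<r)
    ... | t₀ , 0<t₀ , small = x +[ t ] C , +[]∈cone 0<t cx , (begin-strict
      ⟨ z , z ⟩               ≈⟨ ⟨⟩-cong z≋ z≋ ⟩
      ⟨ neg tC , neg tC ⟩     ≈⟨ sum-cong-≋ (λ e → -x*-y≈x*y (tC e) (tC e)) ⟩
      ⟨ tC , tC ⟩             ≈⟨ ⟨⟩-scaleʳ tC t C ⟩
      t * ⟨ tC , C ⟩          ≈⟨ *-congˡ (trans (⟨⟩-comm tC C) (⟨⟩-scaleʳ C t C)) ⟩
      -- The squared distance is quadratic in `t`; the bound `t ≤ 1` makes it linear, as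
      -- `small-multiple` requires.
      t * (t * ⟨ C , C ⟩)     ≤⟨ *-monoˡ-≤ (*-nonneg (proj₁ 0<t) (0≤sum λ e → 0≤x*x (C e))) t≤1 ⟩
      1# * (t * ⟨ C , C ⟩)    ≈⟨ *-identityˡ _ ⟩
      t * ⟨ C , C ⟩           <⟨ small 0<t t≤t₀ ⟩
      r * r                   ∎)
      where
      open import Algebra.Properties.Semiring.Sum semiring using (sum-cong-≋)

      minimum : ∃[ t ] 0# < t × t ≤ t₀ × t ≤ 1#
      minimum with total t₀ 1#
      ... | inj₁ t₀≤1 = t₀ , 0<t₀ , ≤-refl , t₀≤1
      ... | inj₂ 1≤t₀ = 1# , 0<1 , 1≤t₀ , ≤-refl

      t : Carrier
      t = proj₁ minimum

      0<t : 0# < t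
      0<t = proj₁ (proj₂ minimum)

      t≤t₀ : t ≤ t₀
      t≤t₀ = proj₁ (proj₂ (proj₂ minimum))

      t≤1 : t ≤ 1#
      t≤1 = proj₂ (proj₂ (proj₂ minimum))

      z tC : ℝᴱ
      z e = x e - (x +[ t ] C) e
      tC e = t * C e

      z≋ : z ≋ neg tC
      z≋ e = trans (+-congˡ (sym (-‿+-comm (x e) (tC e)))) (z+[-z+x] (x e) (- tC e))

    closure≐criticalCone : closure (cone C) ≐ criticalCone C
    closure≐criticalCone = closure⊆criticalCone , criticalCone⊆closure

  -- Faces of a critical cone.

  module _ {C w c₀ : ℝᴱ} (c₀∈ : face w (criticalCone C) c₀) where
    private
      S : Pred ℝᴱ 0ℓ
      S = face w (criticalCone C)

      -- With `⟨w,S⟩≤0` this says that a maximum of a linear functional attained on a cone is zero: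
      -- the origin belongs to the cone, and so does the double of a maximiser.
      0≤⟨w,S⟩ : ∀ {x} → S x → 0# ≤ ⟨ w , x ⟩
      0≤⟨w,S⟩ (_ , max) = ≤-trans (≤-reflexive (sym (⟨⟩-0ʳ w))) (max _ (criticalCone-0 C))

      S-+ : ∀ {x y} → S x → S y → S (x +[ 1# ] y)
      S-+ {x} {y} (cx , max) y∈@(cy , _) = criticalCone-+[] {C} {1#} {x} {y} (proj₁ 0<1) cx cy , λ z cz → begin
        ⟨ w , z ⟩                   ≤⟨ max z cz ⟩
        ⟨ w , x ⟩                   ≈⟨ +-identityʳ _ ⟨
        ⟨ w , x ⟩ + 0#              ≤⟨ +-monoʳ-≤ ⟨ w , x ⟩ (0≤⟨w,S⟩ y∈) ⟩
        ⟨ w , x ⟩ + ⟨ w , y ⟩       ≈⟨ +-congˡ (*-identityˡ _) ⟨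
        ⟨ w , x ⟩ + 1# * ⟨ w , y ⟩  ≈⟨ ⟨⟩-+[]ʳ w x 1# y ⟨
        ⟨ w , x +[ 1# ] y ⟩         ∎

      ⟨w,S⟩≤0 : ∀ {x} → S x → ⟨ w , x ⟩ ≤ 0#
      ⟨w,S⟩≤0 {x} x∈@(cx , max) = +-cancelˡ-≤ ⟨ w , x ⟩ (begin
        ⟨ w , x ⟩ + ⟨ w , x ⟩       ≈⟨ +-congˡ (*-identityˡ _) ⟨
        ⟨ w , x ⟩ + 1# * ⟨ w , x ⟩  ≈⟨ ⟨⟩-+[]ʳ w x 1# x ⟨
        ⟨ w , x +[ 1# ] x ⟩         ≤⟨ max _ (proj₁ (S-+ x∈ x∈)) ⟩
        ⟨ w , x ⟩                   ≈⟨ +-identityʳ _ ⟨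
        ⟨ w , x ⟩ + 0#              ∎)

      -- If some `s` in the face rejects a path, adding `s` to `c` makes that path non-critical and
      -- creates no new critical paths. Once the list is exhausted, a listed path that is critical
      -- for `c` is critical on the whole face.
      fewest-critical : (xs : List Parallel) → ∃[ c ] S c ×
        (∀ {i j} (π ρ : Path i j) → ((i , j) , π , ρ) ∈ˡ xs → Critical c π → ∀ {s} → S s → Critical s π)
      fewest-critical [] = c₀ , c₀∈ , λ _ _ ()
      fewest-critical ((_ , π , _) ∷ xs) with fewest-critical xs | em {∃[ s ] S s × ¬ Critical s π}
      ... | c , c∈ , few | yes (s , s∈ , s-not) = c +[ 1# ] s , S-+ c∈ s∈ , λ where
        _ _ (here ≡.refl) crit _  → ⊥-elim (s-not (proj₂ (critical-+[]⁻ {C} 0<1 (proj₁ c∈) (proj₁ s∈) π crit)))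
        π ρ (there π∈)    crit s′∈ → few π ρ π∈ (proj₁ (critical-+[]⁻ {C} 0<1 (proj₁ c∈) (proj₁ s∈) π crit)) s′∈
      ... | c , c∈ , few | no none = c , c∈ , λ where
          _ _ (here ≡.refl) crit {s} s∈ → decide s s∈
          π ρ (there π∈)    crit s∈     → few π ρ π∈ crit s∈
        where
        decide : ∀ s → S s → Critical s π
        decide s s∈ with em {Critical s π}
        ... | yes crit = crit
        ... | no  not  = ⊥-elim (none (s , s∈ , not))

    face-of-criticalCone : ∃[ c ] face w (criticalCone C) ≐ criticalCone c
    face-of-criticalCone with fewest-critical parallels
    ... | c , c∈@(cc , max) , few = c , (λ s∈ π π-crit → few π π (∈-parallels π π) π-crit s∈) , ⊇
      where
      ⊇ : criticalCone c ⊆ S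
      ⊇ {x} cx with criticalCone-reflect cx
      -- Since c - tx remains in the critical cone of `C`, the maximality of `w` at `c` yields 0 ≤ ⟨
      -- w , x ⟩, and zero is the maximum.
      ... | t , 0<t , reflected = (λ π → cx π ∘ cc π) , λ z cz → begin
        ⟨ w , z ⟩ ≤⟨ max z cz ⟩
        ⟨ w , c ⟩ ≤⟨ ⟨w,S⟩≤0 c∈ ⟩
        0#        ≤⟨ 0≤⟨w,x⟩ ⟩
        ⟨ w , x ⟩ ∎
        where
        t⟨w,-x⟩≤0 : t * ⟨ w , neg x ⟩ ≤ 0#
        t⟨w,-x⟩≤0 = +-cancelˡ-≤ ⟨ w , c ⟩ (begin
          ⟨ w , c ⟩ + t * ⟨ w , neg x ⟩ ≈⟨ ⟨⟩-+[]ʳ w c t (neg x) ⟨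
          ⟨ w , c +[ t ] neg x ⟩        ≤⟨ max _ (λ π → reflected π ∘ cc π) ⟩
          ⟨ w , c ⟩                     ≈⟨ +-identityʳ _ ⟨
          ⟨ w , c ⟩ + 0#                ∎)

        0≤⟨w,x⟩ : 0# ≤ ⟨ w , x ⟩
        0≤⟨w,x⟩ with em {0# ≤ ⟨ w , x ⟩}
        ... | yes 0≤ = 0≤
        ... | no  0≰ = ⊥-elim (<⇒≱ (begin-strict
          t * ⟨ w , x ⟩ + t * ⟨ w , neg x ⟩  <⟨ +-monoˡ-< _ (*-monoʳ-< 0<t (≰⇒> 0≰)) ⟩
          t * 0# + t * ⟨ w , neg x ⟩         ≤⟨ +-monoʳ-≤ _ t⟨w,-x⟩≤0 ⟩
          t * 0# + 0#                        ≈⟨ trans (+-identityʳ _) (zeroʳ t) ⟩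
          0#                                 ∎) (≤-reflexive (begin-equality
          0#                                 ≈⟨ zeroʳ t ⟨
          t * 0#                             ≈⟨ *-congˡ (⟨⟩+⟨neg⟩ x w) ⟨
          t * (⟨ x , w ⟩ + ⟨ neg x , w ⟩)    ≈⟨ *-congˡ (+-cong (⟨⟩-comm x w) (⟨⟩-comm (neg x) w)) ⟩
          t * (⟨ w , x ⟩ + ⟨ w , neg x ⟩)    ≈⟨ distribˡ t _ _ ⟩
          t * ⟨ w , x ⟩ + t * ⟨ w , neg x ⟩  ∎)))

  -- Critical cones as faces.

  ⟨⟩-gap : ∀ {i j} (π ρ : Path i j) → ∃[ d ] ∀ x → ⟨ d , x ⟩ + weight x π ≈ weight x ρ
  ⟨⟩-gap π ρ = edgeVector ρ +[ 1# ] neg (edgeVector π) , λ x →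
    let r  = ⟨ edgeVector ρ , x ⟩
        p  = ⟨ edgeVector π , x ⟩
        -p = ⟨ neg (edgeVector π) , x ⟩
    in begin-equality
    ⟨ edgeVector ρ +[ 1# ] neg (edgeVector π) , x ⟩ + weight x π
                       ≈⟨ +-congʳ (⟨⟩-+[]ˡ (edgeVector ρ) 1# (neg (edgeVector π)) x) ⟩
    r + 1# * -p + weight x π
                       ≈⟨ +-cong (+-congˡ (*-identityˡ -p)) (sym (trans (⟨⟩-comm (edgeVector π) x) (⟨⟩-edgeVector x π))) ⟩
    r + -p + p         ≈⟨ solve 3 (λ r p q → (r :+ q) :+ p := r :+ (p :+ q)) refl r p -p ⟩
    r + (p + -p)       ≈⟨ +-cong (trans (⟨⟩-comm (edgeVector ρ) x) (⟨⟩-edgeVector x ρ)) (⟨⟩+⟨neg⟩ (edgeVector π) x) ⟩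
    weight x ρ + 0#    ≈⟨ +-identityʳ _ ⟩
    weight x ρ         ∎

  module _ {C u : ℝᴱ} (Cu : criticalCone C u) where
    private
      -- Here `w` is the sum of the gaps weight ρ - weight π over the listed pairs with `π` critical
      -- for `C` and `ρ` critical for `u`. On the critical cone of `C` no gap is positive, on that
      -- of `u` none is negative. A sum of nonpositive gaps that is at least zero forces every gap
      -- to vanish.
      Supporting : List Parallel → ℝᴱ → ℝᴱ → Set
      Supporting xs w x =
        ⟨ w , x ⟩ ≤ 0# × (criticalCone u x → 0# ≤ ⟨ w , x ⟩) ×
        (0# ≤ ⟨ w , x ⟩ → ∀ {i j} (π ρ : Path i j) → ((i , j) , π , ρ) ∈ˡ xs →
         Critical C π → Critical u ρ → weight x π ≤ weight x ρ)

      supporting-∷ : ∀ {xs w d x i j} {π ρ : Path i j} → criticalCone C x → Critical C π → Critical u ρ →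
                     ⟨ d , x ⟩ + weight x π ≈ weight x ρ →
                     Supporting xs w x → Supporting (((i , j) , π , ρ) ∷ xs) (w +[ 1# ] d) x
      supporting-∷ {xs} {w} {d} {x} {π = π} {ρ} cx π-crit ρ-crit gap (W≤0 , 0≤W , tight) =
        (begin
          ⟨ w +[ 1# ] d , x ⟩ ≈⟨ split ⟩
          W + D               ≤⟨ +-mono-≤ W≤0 D≤0 ⟩
          0# + 0#             ≈⟨ +-identityˡ 0# ⟩
          0#                  ∎) ,
        (λ ux → begin
          0#                  ≈⟨ +-identityˡ 0# ⟨
          0# + 0#             ≤⟨ +-mono-≤ (0≤W ux) (0≤D ux) ⟩
          W + D               ≈⟨ split ⟨
          ⟨ w +[ 1# ] d , x ⟩ ∎) ,
        tight′
        where
        W D : Carrier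
        W = ⟨ w , x ⟩
        D = ⟨ d , x ⟩

        split : ⟨ w +[ 1# ] d , x ⟩ ≈ W + D
        split = trans (⟨⟩-+[]ˡ w 1# d x) (+-congˡ (*-identityˡ _))

        D≤0 : D ≤ 0#
        D≤0 = +-cancelʳ-≤ (weight x π) (begin
          D + weight x π  ≈⟨ gap ⟩
          weight x ρ      ≤⟨ cx π π-crit ρ ⟩
          weight x π      ≈⟨ +-identityˡ _ ⟨
          0# + weight x π ∎)

        0≤D : criticalCone u x → 0# ≤ D
        0≤D ux = +-cancelʳ-≤ (weight x π) (begin
          0# + weight x π ≈⟨ +-identityˡ _ ⟩
          weight x π      ≤⟨ ux ρ ρ-crit π ⟩
          weight x ρ      ≈⟨ gap ⟨
          D + weight x π  ∎)

        tight′ : 0# ≤ ⟨ w +[ 1# ] d , x ⟩ → ∀ {i j} (σ τ : Path i j) → ((i , j) , σ , τ) ∈ˡ (_ , π , ρ) ∷ xs →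
                 Critical C σ → Critical u τ → weight x σ ≤ weight x τ
        tight′ 0≤w+d _ _ (here ≡.refl) _ _ = begin
          weight x π      ≈⟨ +-identityˡ _ ⟨
          0# + weight x π ≤⟨ +-monoˡ-≤ _ (begin
            0#                  ≤⟨ 0≤w+d ⟩
            ⟨ w +[ 1# ] d , x ⟩ ≈⟨ split ⟩
            W + D               ≤⟨ +-monoˡ-≤ D W≤0 ⟩
            0# + D              ≈⟨ +-identityˡ D ⟩
            D                   ∎) ⟩
          D + weight x π  ≈⟨ gap ⟩
          weight x ρ      ∎
        tight′ 0≤w+d σ τ (there ∈xs) = tight (begin
          0#                  ≤⟨ 0≤w+d ⟩
          ⟨ w +[ 1# ] d , x ⟩ ≈⟨ split ⟩
          W + D               ≤⟨ +-monoʳ-≤ W D≤0 ⟩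
          W + 0#              ≈⟨ +-identityʳ W ⟩
          W                   ∎) σ τ ∈xs

      supporting : (xs : List Parallel) → ∃[ w ] ∀ {x} → criticalCone C x → Supporting xs w x
      supporting [] = (λ _ → 0#) , λ {x} _ →
        ≤-reflexive (⟨0,x⟩≈0 x) , (λ _ → ≤-reflexive (sym (⟨0,x⟩≈0 x))) , λ _ _ _ ()
        where
        ⟨0,x⟩≈0 : ∀ x → ⟨ (λ _ → 0#) , x ⟩ ≈ 0#
        ⟨0,x⟩≈0 x = trans (⟨⟩-comm _ x) (⟨⟩-0ʳ x)
      supporting ((_ , π , ρ) ∷ xs) with supporting xs | em {Critical C π × Critical u ρ}
      ... | w , supp | no not = w , λ cx → let W≤0 , 0≤W , tight = supp cx in W≤0 , 0≤W , λ where
        _   _ _ (here ≡.refl) π-crit ρ-crit → ⊥-elim (not (π-crit , ρ-crit))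
        0≤w σ τ (there ∈xs)                 → tight 0≤w σ τ ∈xs
      ... | w , supp | yes (π-crit , ρ-crit) with ⟨⟩-gap π ρ
      ...   | d , gap = w +[ 1# ] d , λ {x} cx → supporting-∷ cx π-crit ρ-crit (gap x) (supp cx)

    criticalCone-is-face : ∃[ w ] criticalCone u ≐ face w (criticalCone C)
    criticalCone-is-face with supporting parallels
    ... | w , supp = w , ⊆-face , face-⊆
      where
      ⊆-face : criticalCone u ⊆ face w (criticalCone C)
      ⊆-face ux = Cx , λ y Cy → ≤-trans (proj₁ (supp Cy)) (proj₁ (proj₂ (supp Cx)) ux)
        where
        Cx : criticalCone C _
        Cx π = ux π ∘ Cu π

      face-⊆ : face w (criticalCone C) ⊆ criticalCone u
      face-⊆ {x} (Cx , max) ρ ρ-crit σ with critical-exists C ρ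
      ... | π , π-crit = ≤-trans (Cx π π-crit σ)
        -- The point `u` lies in both cones, so the value of `w` at `u`, and hence at the maximiser
        -- `x`, is at least zero.
        (proj₂ (proj₂ (supp Cx)) (≤-trans (proj₁ (proj₂ (supp Cu)) (λ _ → id)) (max u Cu))
          π ρ (∈-parallels π ρ) π-crit ρ-crit)

  -- Generic refinements.

  0≤weight : ∀ {w} → (∀ e → 0# ≤ w e) → ∀ {i j} (π : Path i j) → 0# ≤ weight w π
  0≤weight 0≤w π = ≤-trans (≤-reflexive (sym (weight-0 π))) (weight-mono 0≤w π)

  weight-δ-0 : ∀ {e i k j} → src e ≡ i → i ⟶ k → (π : Path k j) → weight (δ e) π ≈ 0#
  weight-δ-0 {e} ≡.refl a π = go π (no-cycle a)
    where
    go : ∀ {k j} (π : Path k j) → ¬ Path k (src e) → weight (δ e) π ≈ 0#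
    go ε             _   = refl
    go (b@(e′ , ≡.refl , _) ◅ π) k↝̸ = trans
      (+-cong (reflexive (δ-off-diagonal {a = e} {e′} (λ { ≡.refl → k↝̸ ε }))) (go π (k↝̸ ∘ (b ◅_))))
      (+-identityˡ 0#)

  -- The indicator of an edge of `π` at the point of divergence: `ρ` leaves the source of that edge
  -- by another edge and cannot return to it.
  separating-weight : ∀ {i j} (π ρ : Path i j) → π ≢ ρ → ∃[ w ] ¬ (weight w π ≈ weight w ρ)
  separating-weight ε       ρ       π≢ρ = ⊥-elim (π≢ρ (≡.sym (cycle-trivial ρ)))
  separating-weight (a ◅ π) ε       π≢ρ = ⊥-elim (no-cycle a π)
  separating-weight (a@(e , p , q) ◅ π) (b@(e′ , p′ , q′) ◅ ρ) π≢ρ with e ≟ e′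
  ... | no e≢e′ = δ e , λ eq → <⇒≱ 0<1 (begin
    1#                           ≈⟨ reflexive (δ-diagonal e) ⟨
    δ e e                        ≈⟨ +-identityʳ _ ⟨
    δ e e + 0#                   ≤⟨ +-monoʳ-≤ _ (0≤weight (0≤δ e) π) ⟩
    δ e e + weight (δ e) π       ≈⟨ eq ⟩
    δ e e′ + weight (δ e) ρ      ≈⟨ +-cong (reflexive (δ-off-diagonal e≢e′)) (weight-δ-0 p b ρ) ⟩
    0# + 0#                      ≈⟨ +-identityˡ 0# ⟩
    0#                           ∎)
  separating-weight ((e , ≡.refl , ≡.refl) ◅ π) ((e , ≡.refl , ≡.refl) ◅ ρ) π≢ρ | yes ≡.refl
    with separating-weight π ρ (λ { ≡.refl → π≢ρ ≡.refl })
  ... | w , w-sep = w , λ eq → w-sep (+-cancelˡ (w e) _ _ eq)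

  ≉⇒<⊎> : ∀ {x y} → ¬ (x ≈ y) → x < y ⊎ y < x
  ≉⇒<⊎> {x} {y} x≉y with total x y
  ... | inj₁ x≤y = inj₁ (x≤y , x≉y)
  ... | inj₂ y≤x = inj₂ (y≤x , x≉y ∘ sym)

  module _ (u : ℝᴱ) where
    private
      -- Ties are broken one at a time. A step size that keeps every strict inequality of the
      -- current `C` keeps those inherited from `u` and also the ties already broken.
      distinguishing : (xs : List Parallel) → ∃[ C ]
        (∀ {i j} (π ρ : Path i j) → weight u π < weight u ρ → weight C π < weight C ρ) ×
        (∀ {i j} (π ρ : Path i j) → ((i , j) , π , ρ) ∈ˡ xs → π ≢ ρ → ¬ (weight C π ≈ weight C ρ))
      distinguishing [] = u , (λ _ _ → id) , λ _ _ ()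
      distinguishing ((_ , π , ρ) ∷ xs) with distinguishing xs
      ... | C , preserved , distinct with em {π ≢ ρ × weight C π ≈ weight C ρ}
      ...   | no not = C , preserved , λ where
        _ _ (here ≡.refl) π≢ρ Cπ≈Cρ → not (π≢ρ , Cπ≈Cρ)
        σ τ (there ∈xs)             → distinct σ τ ∈xs
      ...   | yes (π≢ρ , Cπ≈Cρ) with separating-weight π ρ π≢ρ
      ...     | w , w-sep with perturb-weight C w
      ...       | t , 0<t , small = C +[ t ] w , (λ σ τ → small σ τ ∘ preserved σ τ) , λ where
          _ _ (here ≡.refl) _ eq → moved eq
          σ τ (there ∈xs) σ≢τ eq → kept σ τ (≉⇒<⊎> (distinct σ τ ∈xs σ≢τ)) eq
        where
        kept : ∀ {i j} (σ τ : Path i j) → weight C σ < weight C τ ⊎ weight C τ < weight C σ →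
               ¬ (weight (C +[ t ] w) σ ≈ weight (C +[ t ] w) τ)
        kept σ τ (inj₁ σ<τ) eq = proj₂ (small σ τ σ<τ) eq
        kept σ τ (inj₂ τ<σ) eq = proj₂ (small τ σ τ<σ) (sym eq)

        t*w≈ : weight (C +[ t ] w) π ≈ weight (C +[ t ] w) ρ → t * weight w π ≈ t * weight w ρ
        t*w≈ eq = +-cancelˡ (weight C π) _ _ (begin-equality
          weight C π + t * weight w π ≈⟨ weight-+[] C t w π ⟨
          weight (C +[ t ] w) π       ≈⟨ eq ⟩
          weight (C +[ t ] w) ρ       ≈⟨ weight-+[] C t w ρ ⟩
          weight C ρ + t * weight w ρ ≈⟨ +-congʳ Cπ≈Cρ ⟨
          weight C π + t * weight w ρ ∎)

        moved : ¬ (weight (C +[ t ] w) π ≈ weight (C +[ t ] w) ρ)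
        moved eq with ≉⇒<⊎> w-sep
        ... | inj₁ wπ<wρ = proj₂ (*-monoʳ-< 0<t wπ<wρ) (t*w≈ eq)
        ... | inj₂ wρ<wπ = proj₂ (*-monoʳ-< 0<t wρ<wπ) (sym (t*w≈ eq))

    generic-refinement : ∃[ C ] Generic C × criticalCone C u
    generic-refinement with distinguishing parallels
    ... | C , preserved , distinct = C , gen , u∈
      where
      gen : Generic C
      gen i j i≢j π₀ with critical-exists C π₀
      ... | π , π-crit = π , π-crit , unique
        where
        unique : ∀ ρ → Critical C ρ → ρ ≡ π
        unique ρ ρ-crit with em {ρ ≡ π}
        ... | yes ρ≡π = ρ≡π
        ... | no  ρ≢π = ⊥-elim (distinct ρ π (∈-parallels ρ π) ρ≢π (≤-antisym (π-crit ρ) (ρ-crit π)))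

      u∈ : criticalCone C u
      u∈ π π-crit ρ with em {weight u ρ ≤ weight u π}
      ... | yes uρ≤uπ = uρ≤uπ
      ... | no  uρ≰uπ = ⊥-elim (<⇒≱ (preserved π ρ (≰⇒> uρ≰uπ)) (π-crit ρ))

-- Polytopes through the values of linear functionals.

module SupportFunctions (ℝ : CompleteOrderedField) (n : ℕ) where
  open CompleteOrderedField ℝ hiding (zero)
  open OrderedField ℝ
  open ≤-Reasoning
  open Euclidean ℝ n
  open EuclideanProperties ℝ n
  open Polynomial ℝ n
  open Indicator ℝ
  open import Algebra.Properties.Semiring.Sum semiring using (sum; *-distribʳ-sum)
  open import Algebra.Properties.Semiring.Mult semiring using (×-homo-+; ×-homo-1)
    renaming (_×_ to _·_)

  -- val c a is the value of the linear functional c at the point labelled a;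
  -- Q behaves like the convex hull of the labelled points.
  record Supports {A : Set} (val : ℝⁿ → A → Carrier) (Q : Pred ℝⁿ 0ℓ) : Set where
    field
      attained : ∀ a → ∃[ v ] Q v × (∀ c → ⟨ c , v ⟩ ≈ val c a)
      bounded  : ∀ c a → (∀ b → val c b ≤ val c a) → ∀ {y} → Q y → ⟨ c , y ⟩ ≤ val c a

  _+ᵛ_ : {A B : Set} → (ℝⁿ → A → Carrier) → (ℝⁿ → B → Carrier) → ℝⁿ → A × B → Carrier
  (val +ᵛ val′) c (a , b) = val c a + val′ c b

  maximal-pair : ∀ {A B : Set} (f : A → Carrier) (g : B → Carrier) {a b} →
                 (∀ ((x , y) : A × B) → f x + g y ≤ f a + g b) →
                 (∀ x → f x ≤ f a) × (∀ y → g y ≤ g b)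
  maximal-pair f g {a} {b} max =
    (λ x → +-cancelʳ-≤ (g b) (max (x , b))) , (λ y → +-cancelˡ-≤ (f a) (max (a , y)))

  origin-supports : Supports {⊤} (λ _ _ → 0#) origin
  origin-supports = record
    { attained = λ _ → (λ _ → 0#) , (λ _ → refl) , ⟨⟩-0ʳ
    ; bounded  = λ c _ _ y≋0 → ≤-reflexive (trans (⟨⟩-cong (λ _ → refl) y≋0) (⟨⟩-0ʳ c))
    }

  ⊕-supports : ∀ {A B val val′ Q R} → Supports {A} val Q → Supports {B} val′ R →
               Supports (val +ᵛ val′) (Q ⊕ R)
  ⊕-supports {val = val} {val′} Q-supp R-supp = record
    { attained = λ (a , b) →
        let v , Qv , v-val = Q.attained a
            w , Rw , w-val = R.attained b
        in (λ e → v e + w e) , (v , w , Qv , Rw , λ _ → refl) ,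
           λ c → trans (⟨⟩-+ʳ c v w) (+-cong (v-val c) (w-val c))
    ; bounded = λ c (a , b) max {y} (v , w , Qv , Rw , y≋v+w) →
        let max-a , max-b = maximal-pair (val c) (val′ c) max
        in ≤-trans
          (≤-reflexive (trans (⟨⟩-cong (λ _ → refl) y≋v+w) (⟨⟩-+ʳ c v w)))
          (+-mono-≤ (Q.bounded c a max-a Qv) (R.bounded c b max-b Rw))
    }
    where
    module Q = Supports Q-supp
    module R = Supports R-supp

  ⟨⟩-combination : ∀ {k} u (c : Vector Carrier k) (a : Vector ℝⁿ k) →
                   ⟨ u , (λ e → sum (λ t → c t * a t e)) ⟩ ≈ sum (λ t → c t * ⟨ u , a t ⟩)
  ⟨⟩-combination {zero}  u c a = ⟨⟩-0ʳ u
  ⟨⟩-combination {suc k} u c a = trans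
    (⟨⟩-+ʳ u (λ e → c zero * a zero e) (λ e → sum (λ t → c (suc t) * a (suc t) e)))
    (+-cong (⟨⟩-scaleʳ u (c zero) (a zero)) (⟨⟩-combination u (c ∘ suc) (a ∘ suc)))

  conv-bounded : ∀ {A : Pred ℝⁿ 0ℓ} {u M} → (∀ {x} → A x → ⟨ u , x ⟩ ≤ M) → ∀ {y} → conv A y → ⟨ u , y ⟩ ≤ M
  conv-bounded {u = u} {M} A≤M {y} (k , c , a , 0≤c , ∑c≈1 , a∈A , y≋) = begin
    ⟨ u , y ⟩                               ≈⟨ ⟨⟩-cong (λ _ → refl) y≋ ⟩
    ⟨ u , (λ e → sum (λ t → c t * a t e)) ⟩ ≈⟨ ⟨⟩-combination u c a ⟩
    sum (λ t → c t * ⟨ u , a t ⟩)           ≤⟨ sum-mono-≤ (λ t → *-monoʳ-≤ (0≤c t) (A≤M (a∈A t))) ⟩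
    sum (λ t → c t * M)                     ≈⟨ *-distribʳ-sum M c ⟨
    sum c * M                               ≈⟨ *-congʳ ∑c≈1 ⟩
    1# * M                                  ≈⟨ *-identityˡ M ⟩
    M                                       ∎

  ⊆conv : ∀ {A : Pred ℝⁿ 0ℓ} → A ⊆ conv A
  ⊆conv {x = x} x∈A = 1 , (λ _ → 1#) , (λ _ → x) , (λ _ → proj₁ 0<1) , +-identityʳ 1# , (λ _ → x∈A) ,
    λ e → sym (trans (+-identityʳ _) (*-identityˡ (x e)))

  -- Since every listed term has coefficient one, collecting equal exponents gives coefficients of
  -- at least one, and the listed exponents are exactly the support. Several labels may share an
  -- exponent, hence the separate fields `term` and `label`.
  record HasTerms {A : Set} (val : ℝⁿ → A → Carrier) (f : Poly) : Set where
    field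
      monic : All (λ (c , _) → c ≈ 1#) f
      term  : ∀ a → ∃[ c ] ∃[ α ] (c , α) ∈ˡ f × (∀ u → ⟨ u , toℝⁿ α ⟩ ≈ val u a)
      label : ∀ {c α} → (c , α) ∈ˡ f → ∃[ a ] (∀ u → ⟨ u , toℝⁿ α ⟩ ≈ val u a)

  coeff-support : ∀ f {α} → ¬ (coeff f α ≈ 0#) → ∃[ c ] (c , α) ∈ˡ f
  coeff-support []            ≉0 = ⊥-elim (≉0 refl)
  coeff-support ((c , β) ∷ f) {α} ≉0 with ≡-dec _≟ℕ_ β α
  ... | yes ≡.refl = c , here ≡.refl
  ... | no  _      with coeff-support f ≉0
  ...   | c′ , ∈f = c′ , there ∈f

  0≤coeff : ∀ {f} → All (λ (c , _) → c ≈ 1#) f → ∀ α → 0# ≤ coeff f α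
  0≤coeff []                          α = ≤-refl
  0≤coeff {(c , β) ∷ f} (c≈1 ∷ monic) α with ≡-dec _≟ℕ_ β α
  ... | no  _ = 0≤coeff monic α
  ... | yes _ = begin
    0#            ≈⟨ +-identityˡ 0# ⟨
    0# + 0#       ≤⟨ +-mono-≤ (proj₁ 0<1) (0≤coeff monic α) ⟩
    1# + coeff f α ≈⟨ +-congʳ c≈1 ⟨
    c + coeff f α ∎

  1≤coeff : ∀ {f} → All (λ (c , _) → c ≈ 1#) f → ∀ {c α} → (c , α) ∈ˡ f → 1# ≤ coeff f α
  1≤coeff {(c , β) ∷ f} (c≈1 ∷ monic) {α = α} c∈ with ≡-dec _≟ℕ_ β α | c∈
  ... | no  β≢α | here ≡.refl = ⊥-elim (β≢α ≡.refl)
  ... | no  _   | there c∈f   = 1≤coeff monic c∈f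
  ... | yes _   | _           = begin
    1#             ≈⟨ +-identityʳ 1# ⟨
    1# + 0#        ≤⟨ +-monoʳ-≤ 1# (0≤coeff monic α) ⟩
    1# + coeff f α ≈⟨ +-congʳ c≈1 ⟨
    c + coeff f α  ∎

  Newt-supports : ∀ {A val f} → HasTerms {A} val f → Supports val (Newt f)
  Newt-supports {val = val} {f} terms = record
    { attained = λ a →
        let c , α , ∈f , α-val = term a
        in toℝⁿ α ,
           ⊆conv {Support} (α , (λ ≈0 → <⇒≱ 0<1 (≤-trans (1≤coeff monic ∈f) (≤-reflexive ≈0))) , λ _ → refl) ,
           α-val
    ; bounded = λ u a max → conv-bounded {Support} λ (α , ≉0 , x≋α) →
        let c , ∈f = coeff-support f ≉0
            b , b-val = label ∈f
        in ≤-trans (≤-reflexive (trans (⟨⟩-cong (λ _ → refl) x≋α) (b-val u))) (max b)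
    }
    where
    open HasTerms terms

    Support : Pred ℝⁿ 0ℓ
    Support x = ∃[ α ] ¬ (coeff f α ≈ 0#) × x ≋ toℝⁿ α

  ⟨⟩-toℝⁿ-+ : ∀ u α β → ⟨ u , toℝⁿ (Vec.zipWith ℕ._+_ α β) ⟩ ≈ ⟨ u , toℝⁿ α ⟩ + ⟨ u , toℝⁿ β ⟩
  ⟨⟩-toℝⁿ-+ u α β = trans
    (⟨⟩-cong {u} (λ _ → refl) λ e → trans
      (reflexive (≡.cong (_· 1#) (lookup-zipWith ℕ._+_ e α β)))
      (×-homo-+ 1# (Vec.lookup α e) (Vec.lookup β e)))
    (⟨⟩-+ʳ u (toℝⁿ α) (toℝⁿ β))

  ⟨⟩-toℝⁿ-0 : ∀ u → ⟨ u , toℝⁿ (Vec.replicate n 0) ⟩ ≈ 0#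
  ⟨⟩-toℝⁿ-0 u = trans
    (⟨⟩-cong {u} (λ _ → refl) λ e → reflexive (≡.cong (_· 1#) (lookup-replicate e 0)))
    (⟨⟩-0ʳ u)

  ⟨⟩-toℝⁿ-var : ∀ u a → ⟨ u , toℝⁿ (Vec.replicate n 0 Vec.[ a ]≔ 1) ⟩ ≈ u a
  ⟨⟩-toℝⁿ-var u a = trans (⟨⟩-cong {u} (λ _ → refl) (lookup-var a)) (⟨x,δ⟩ u a)
    where
    lookup-var : ∀ {m} (a e : Fin m) → Vec.lookup (Vec.replicate m 0 Vec.[ a ]≔ 1) e · 1# ≈ δ a e
    lookup-var zero    zero    = ×-homo-1 1#
    lookup-var zero    (suc e) = reflexive (≡.cong (_· 1#) (lookup-replicate e 0))
    lookup-var (suc a) zero    = refl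
    lookup-var (suc a) (suc e) = lookup-var a e

  1ₚ-terms : HasTerms {⊤} (λ _ _ → 0#) 1ₚ
  1ₚ-terms = record
    { monic = refl ∷ []
    ; term  = λ _ → 1# , _ , here ≡.refl , ⟨⟩-toℝⁿ-0
    ; label = λ { (here ≡.refl) → tt , ⟨⟩-toℝⁿ-0 }
    }

  *ₚ-terms : ∀ {A B val val′ f g} → HasTerms {A} val f → HasTerms {B} val′ g →
             HasTerms (val +ᵛ val′) (f *ₚ g)
  *ₚ-terms {f = f} {g} f-terms g-terms = record
    { monic = All.tabulate λ ∈fg → monic (∈-cartesianProductWith⁻ _ f g ∈fg)
    ; term  = λ (a , b) →
        let _ , α , ∈f , α-val = F.term a
            _ , β , ∈g , β-val = G.term b
        in _ , _ , ∈-cartesianProductWith⁺ _ ∈f ∈g , λ u → trans (⟨⟩-toℝⁿ-+ u α β) (+-cong (α-val u) (β-val u))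
    ; label = λ ∈fg → label (∈-cartesianProductWith⁻ _ f g ∈fg)
    }
    where
    module F = HasTerms f-terms
    module G = HasTerms g-terms

    Product : Carrier × Exponent → Set
    Product t = ∃[ x ] ∃[ y ] x ∈ˡ f × y ∈ˡ g × t ≡ (proj₁ x * proj₁ y , Vec.zipWith ℕ._+_ (proj₂ x) (proj₂ y))

    monic : ∀ {t} → Product t → proj₁ t ≈ 1#
    monic (_ , _ , ∈f , ∈g , ≡.refl) =
      trans (*-cong (All.lookup F.monic ∈f) (All.lookup G.monic ∈g)) (*-identityˡ 1#)

    label : ∀ {t} → Product t → ∃[ ab ] (∀ u → ⟨ u , toℝⁿ (proj₂ t) ⟩ ≈ _)
    label ((_ , α) , (_ , β) , ∈f , ∈g , ≡.refl) =
      let a , a-val = F.label ∈f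
          b , b-val = G.label ∈g
      in (a , b) , λ u → trans (⟨⟩-toℝⁿ-+ u α β) (+-cong (a-val u) (b-val u))

-- Normal fans and their comparison with the maxoid fan.

module NormalFans (em : ExcludedMiddle 0ℓ) (ℝ : CompleteOrderedField) (G : DAG) where
  open CompleteOrderedField ℝ hiding (zero)
  open OrderedField ℝ
  open ≤-Reasoning
  open DAG G
  open Paths G
  open CriticalPaths em ℝ G
  open CriticalCones em ℝ G
  open Maxoid ℝ G
  open Euclidean ℝ ∣E∣
  open EuclideanProperties ℝ ∣E∣
  open Polynomial ℝ ∣E∣
  open SupportFunctions ℝ ∣E∣

  monomial : ∀ {i j} (π : Path i j) → ∃[ c ] ∃[ α ] ∏ₚ (map var (edges π)) ≡ (c , α) ∷ [] ×
             c ≈ 1# × (∀ u → ⟨ u , toℝⁿ α ⟩ ≈ weight u π)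
  monomial ε = 1# , _ , ≡.refl , refl , ⟨⟩-toℝⁿ-0
  monomial ((e , _) ◅ π) with monomial π
  ... | c , α , eq , c≈1 , α-val = 1# * c , _ , ≡.cong (var e *ₚ_) eq , trans (*-identityˡ c) c≈1 ,
    λ u → trans (⟨⟩-toℝⁿ-+ u (Vec.replicate ∣E∣ 0 Vec.[ e ]≔ 1) α) (+-cong (⟨⟩-toℝⁿ-var u e) (α-val u))

  pathPolynomial-terms : ∀ i j → HasTerms (λ u → weight u {i} {j}) (pathPolynomial i j)
  pathPolynomial-terms i j = record
    { monic = All.tabulate λ {t} ∈f → proj₁ (path-of ∈f)
    ; term  = λ π → let c , α , eq , _ , α-val = monomial π in
        c , α , ∈-concatMap⁺ _ (lose (∈-P π) (≡.subst ((c , α) ∈ˡ_) (≡.sym eq) (here ≡.refl))) , α-val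
    ; label = λ ∈f → proj₂ (path-of ∈f)
    }
    where
    path-of : ∀ {t} → t ∈ˡ pathPolynomial i j →
              proj₁ t ≈ 1# × ∃[ π ] (∀ u → ⟨ u , toℝⁿ (proj₂ t) ⟩ ≈ weight u {i} {j} π)
    path-of {t} ∈f with find (∈-concatMap⁻ (λ π → ∏ₚ (map var (edges π))) {xs = P i j} ∈f)
    ... | π , _ , ∈π with monomial π
    ...   | c , α , eq , c≈1 , α-val with ≡.subst (t ∈ˡ_) eq ∈π
    ...     | here ≡.refl = c≈1 , π , α-val

  Selection : List (V × V) → Set
  Selection []             = ⊤
  Selection ((i , j) ∷ ps) = Path i j × Selection ps

  total-weight : ∀ ps → ℝᴱ → Selection ps → Carrier
  total-weight []             = λ _ _ → 0#
  total-weight ((i , j) ∷ ps) = (λ u → weight u {i} {j}) +ᵛ total-weight ps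

  minkowskiSum-supports : ∀ ps → Supports (total-weight ps) (minkowskiSum (map (Newt ∘ uncurry pathPolynomial) ps))
  minkowskiSum-supports []             = origin-supports
  minkowskiSum-supports ((i , j) ∷ ps) =
    ⊕-supports (Newt-supports (pathPolynomial-terms i j)) (minkowskiSum-supports ps)

  product-terms : ∀ ps → HasTerms (total-weight ps) (∏ₚ (map (uncurry pathPolynomial) ps))
  product-terms []             = 1ₚ-terms
  product-terms ((i , j) ∷ ps) = *ₚ-terms (pathPolynomial-terms i j) (product-terms ps)

  Maximal : ∀ ps → ℝᴱ → Selection ps → Set
  Maximal ps u σ = ∀ τ → total-weight ps u τ ≤ total-weight ps u σ

  maximal-∷⁻ : ∀ {i j} ps u (π : Path i j) σ → Maximal ((i , j) ∷ ps) u (π , σ) → Critical u π × Maximal ps u σ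
  maximal-∷⁻ ps u π σ = maximal-pair (weight u) (total-weight ps u) {π} {σ}

  maximal-∷⁺ : ∀ {i j} ps u (π : Path i j) σ → Critical u π → Maximal ps u σ → Maximal ((i , j) ∷ ps) u (π , σ)
  maximal-∷⁺ ps u _ _ π-crit σ-max (ρ , τ) = +-mono-≤ (π-crit ρ) (σ-max τ)

  maximal-transfer : ∀ ps u x → criticalCone u x → ∀ σ → Maximal ps u σ → Maximal ps x σ
  maximal-transfer []             _ _ _  _       _   _ = ≤-refl
  maximal-transfer ((i , j) ∷ ps) u x ux (π , σ) max with maximal-∷⁻ ps u π σ max
  ... | π-crit , σ-max = maximal-∷⁺ ps x π σ (ux π π-crit) (maximal-transfer ps u x ux σ σ-max)

  maximal-exists : ∀ {ps} → All (uncurry Path) ps → ∀ u → ∃[ σ ] Maximal ps u σ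
  maximal-exists []       u = tt , λ _ → ≤-refl
  maximal-exists (_∷_ {xs = ps} π₀ πs) u with critical-exists u π₀ | maximal-exists πs u
  ... | π , π-crit | σ , σ-max = (π , σ) , maximal-∷⁺ ps u π σ π-crit σ-max

  -- Critical paths at all other pairs complete `ρ` to a maximal selection. The summands vary
  -- independently, so maximality of the total forces `ρ` to be critical.
  maximal-through : ∀ {ps} → All (uncurry Path) ps → ∀ u {i j} (ρ : Path i j) → Critical u ρ → (i , j) ∈ˡ ps →
                    ∃[ σ ] Maximal ps u σ × (∀ x → Maximal ps x σ → Critical x ρ)
  maximal-through (_∷_ {xs = ps} _ πs) u ρ ρ-crit (here ≡.refl) with maximal-exists πs u
  ... | σ , σ-max = (ρ , σ) , maximal-∷⁺ ps u ρ σ ρ-crit σ-max , λ x max → proj₁ (maximal-∷⁻ ps x ρ σ max)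
  maximal-through (_∷_ {xs = ps} π₀ πs) u ρ ρ-crit (there ij∈)
    with critical-exists u π₀ | maximal-through πs u ρ ρ-crit ij∈
  ... | π , π-crit | σ , σ-max , through = (π , σ) , maximal-∷⁺ ps u π σ π-crit σ-max ,
    λ x max → through x (proj₂ (maximal-∷⁻ ps x π σ max))

  connected⁺ : ∀ {i j} → i ≢ j → Path i j → (i , j) ∈ˡ connectedPairs
  connected⁺ {i} {j} i≢j π =
    ∈-filter⁺ _ (∈-cartesianProduct⁺ (∈-allFin i) (∈-allFin j)) (i≢j , ∈-length (∈-P π))

  connected⁻ : All (uncurry Path) connectedPairs
  connected⁻ = All.tabulate λ ij∈ →
    first (P _ _) (proj₂ (proj₂ (∈-filter⁻ _ {xs = cartesianProduct (allFin ∣V∣) (allFin ∣V∣)} ij∈)))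
    where
    first : ∀ {A : Set} (xs : List A) → 1 ℕ.≤ length xs → A
    first (x ∷ _) _ = x

  module _ {Q : Pred ℝᴱ 0ℓ} (Q-supp : Supports (total-weight connectedPairs) Q) where
    open Supports Q-supp

    maximal∈face : ∀ {u} σ → Maximal connectedPairs u σ →
                   ∃[ v ] face u Q v × (∀ c → ⟨ c , v ⟩ ≈ total-weight connectedPairs c σ)
    maximal∈face {u} σ σ-max with attained σ
    ... | v , Qv , v-val = v ,
      (Qv , λ y Qy → ≤-trans (bounded u σ σ-max Qy) (≤-reflexive (sym (v-val u)))) , v-val

    face-nonempty : ∀ u → Satisfiable (face u Q)
    face-nonempty u with maximal-exists connected⁻ u
    ... | σ , σ-max with maximal∈face {u} σ σ-max
    ...   | v , v∈ , _ = v , v∈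

    normalCone-face : ∀ u → normalCone Q (face u Q) ≐ criticalCone u
    normalCone-face u = ⊆-critical , critical-⊆
      where
      ⊆-critical : normalCone Q (face u Q) ⊆ criticalCone u
      ⊆-critical {x} normal {i} {j} ρ ρ-crit with em {i ≡ j}
      ... | yes ≡.refl = critical-cycle x ρ
      ... | no i≢j with maximal-through connected⁻ u ρ ρ-crit (connected⁺ i≢j ρ)
      ...   | σ , σ-max , through with maximal∈face {u} σ σ-max
      ...     | v , v∈ , v-val = through x x-max
        where
        x-max : Maximal connectedPairs x σ
        x-max τ with attained τ
        ... | w , Qw , w-val = begin
          total-weight connectedPairs x τ ≈⟨ w-val x ⟨
          ⟨ x , w ⟩                       ≤⟨ normal v v∈ w Qw ⟩
          ⟨ x , v ⟩                       ≈⟨ v-val x ⟩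
          total-weight connectedPairs x σ ∎

      critical-⊆ : criticalCone u ⊆ normalCone Q (face u Q)
      -- The point `y` of the face need not be labelled, and `bounded` only bounds values from
      -- above. Applied to u - tx, which is also maximal at `σ`, it gives the reverse inequality ⟨ x
      -- , v ⟩ ≤ ⟨ x , y ⟩.
      critical-⊆ {x} ux y (Qy , y-max) z Qz with maximal-exists connected⁻ u | criticalCone-reflect {u} {x} ux
      ... | σ , σ-max | t , 0<t , reflected with maximal∈face {u} σ σ-max
      ...   | v , (Qv , _) , v-val = begin
        ⟨ x , z ⟩                       ≤⟨ bounded x σ (maximal-transfer connectedPairs u x ux σ σ-max) Qz ⟩
        total-weight connectedPairs x σ ≈⟨ v-val x ⟨
        ⟨ x , v ⟩                       ≤⟨ xv≤xy ⟩
        ⟨ x , y ⟩                       ∎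
        where
        x⁻ : ℝᴱ
        x⁻ = neg x

        reflected≤ : ⟨ u , y ⟩ + t * ⟨ x⁻ , y ⟩ ≤ ⟨ u , v ⟩ + t * ⟨ x⁻ , v ⟩
        reflected≤ = begin
          ⟨ u , y ⟩ + t * ⟨ x⁻ , y ⟩ ≈⟨ ⟨⟩-+[]ˡ u t x⁻ y ⟨
          ⟨ u +[ t ] x⁻ , y ⟩        ≤⟨ bounded (u +[ t ] x⁻) σ
                                          (maximal-transfer connectedPairs u (u +[ t ] x⁻) reflected σ σ-max) Qy ⟩
          total-weight connectedPairs (u +[ t ] x⁻) σ ≈⟨ v-val (u +[ t ] x⁻) ⟨
          ⟨ u +[ t ] x⁻ , v ⟩        ≈⟨ ⟨⟩-+[]ˡ u t x⁻ v ⟩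
          ⟨ u , v ⟩ + t * ⟨ x⁻ , v ⟩ ∎

        x⁻y≤x⁻v : ⟨ x⁻ , y ⟩ ≤ ⟨ x⁻ , v ⟩
        x⁻y≤x⁻v with em {⟨ x⁻ , y ⟩ ≤ ⟨ x⁻ , v ⟩}
        ... | yes p = p
        ... | no ¬p = ⊥-elim (<⇒≱ (*-monoʳ-< 0<t (≰⇒> ¬p))
          (+-cancelˡ-≤ ⟨ u , y ⟩ (≤-trans reflected≤ (+-monoˡ-≤ _ (y-max v Qv)))))

        xv≤xy : ⟨ x , v ⟩ ≤ ⟨ x , y ⟩
        xv≤xy = +-cancelʳ-≤ ⟨ x⁻ , y ⟩ (begin
          ⟨ x , v ⟩ + ⟨ x⁻ , y ⟩ ≤⟨ +-monoʳ-≤ ⟨ x , v ⟩ x⁻y≤x⁻v ⟩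
          ⟨ x , v ⟩ + ⟨ x⁻ , v ⟩ ≈⟨ ⟨⟩+⟨neg⟩ x v ⟩
          0#                     ≈⟨ ⟨⟩+⟨neg⟩ x y ⟨
          ⟨ x , y ⟩ + ⟨ x⁻ , y ⟩ ∎)

    normalCone-cong : ∀ {F F′} → F ≐ F′ → normalCone Q F ≐ normalCone Q F′
    normalCone-cong (F⊆F′ , F′⊆F) = (λ n x → n x ∘ F′⊆F) , (λ n x → n x ∘ F⊆F′)

    criticalCone∈normalFan : ∀ {S} u → S ≐ criticalCone u → normalFan Q S
    criticalCone∈normalFan u S≐ =
      face u Q , (face-nonempty u , u , id , id) , ≐-trans S≐ (≐-sym (normalCone-face u))

    normalFan⁻ : ∀ {S} → normalFan Q S → ∃[ u ] S ≐ criticalCone u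
    normalFan⁻ (F , (_ , u , F≐) , S≐) = u , ≐-trans S≐ (≐-trans (normalCone-cong F≐) (normalCone-face u))

  face-cong : ∀ u S S′ → S ≐ S′ → face u S ≐ face u S′
  face-cong u S S′ (S⊆S′ , S′⊆S) =
    (λ (x∈ , max) → S⊆S′ x∈ , λ y → max y ∘ S′⊆S) , (λ (x∈ , max) → S′⊆S x∈ , λ y → max y ∘ S⊆S′)

  face-of-closure : ∀ {C} → Generic C → ∀ w → face w (closure (cone C)) ≐ face w (criticalCone C)
  face-of-closure {C} C-gen w = face-cong w (closure (cone C)) (criticalCone C) (closure≐criticalCone C-gen)

  criticalCone∈maxoidFan : ∀ {S} u → S ≐ criticalCone u → maxoidFan S
  -- The case `inj₂` covers every `u`: for generic `u` the face obtained is the whole closure.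
  criticalCone∈maxoidFan {S} u S≐ = C , C-gen , inj₂ ((u , proj₂ S≐ (λ _ → id)) , w , S≐face)
    where
    refinement : ∃[ C ] Generic C × criticalCone C u
    refinement = generic-refinement u

    C : ℝᴱ
    C = proj₁ refinement

    C-gen : Generic C
    C-gen = proj₁ (proj₂ refinement)

    supporting-functional : ∃[ w ] criticalCone u ≐ face w (criticalCone C)
    supporting-functional = criticalCone-is-face {C} {u} (proj₂ (proj₂ refinement))

    w : ℝᴱ
    w = proj₁ supporting-functional

    S≐face : S ≐ face w (closure (cone C))
    S≐face = ≐-trans {i = S} {criticalCone u} {face w (closure (cone C))} S≐
      (≐-trans {i = criticalCone u} {face w (criticalCone C)} {face w (closure (cone C))}
        (proj₂ supporting-functional) (≐-sym (face-of-closure C-gen w)))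

  maxoidFan⁻ : ∀ {S} → maxoidFan S → ∃[ u ] S ≐ criticalCone u
  maxoidFan⁻ {S} (C , C-gen , inj₁ S≐) =
    C , ≐-trans {i = S} {closure (cone C)} {criticalCone C} S≐ (closure≐criticalCone C-gen)
  maxoidFan⁻ {S} (C , C-gen , inj₂ ((c₀ , c₀∈) , w , S≐)) =
    c , ≐-trans {i = S} {face w (criticalCone C)} {criticalCone c} S≐face (proj₂ same-cone)
    where
    S≐face : S ≐ face w (criticalCone C)
    S≐face = ≐-trans {i = S} {face w (closure (cone C))} {face w (criticalCone C)} S≐ (face-of-closure C-gen w)

    same-cone : ∃[ c ] face w (criticalCone C) ≐ criticalCone c
    same-cone = face-of-criticalCone {C} {w} {c₀} (proj₁ S≐face c₀∈)

    c : ℝᴱ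
    c = proj₁ same-cone

  -- Only the values of linear functionals on `Q` enter, so one argument serves the Minkowski sum
  -- and the Newton polytope of the product.
  maxoidFan≐normalFan : ∀ Q → Supports (total-weight connectedPairs) Q → maxoidFan ≐ normalFan Q
  maxoidFan≐normalFan Q Q-supp =
    (λ {S} S∈ → let u , S≐ = maxoidFan⁻ {S} S∈ in criticalCone∈normalFan Q-supp {S} u S≐) ,
    (λ {S} S∈ → let u , S≐ = normalFan⁻ Q-supp {S} S∈ in criticalCone∈maxoidFan {S} u S≐)

theorem3p1 : ExcludedMiddle 0ℓ → (ℝ : CompleteOrderedField) (G : DAG) →
    let open DAG G
        open Euclidean ℝ ∣E∣
        open Polynomial ℝ ∣E∣
        open Maxoid ℝ G
    in maxoidFan ≐ normalFan pathPolytope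
     × maxoidFan ≐ normalFan (Newt pathPolynomialProduct)
theorem3p1 em ℝ G =
  maxoidFan≐normalFan pathPolytope (minkowskiSum-supports connectedPairs) ,
  maxoidFan≐normalFan (Newt pathPolynomialProduct) (Newt-supports (product-terms connectedPairs))
  where
  open DAG G
  open Polynomial ℝ ∣E∣
  open Maxoid ℝ G
  open NormalFans em ℝ G
  open SupportFunctions ℝ ∣E∣
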